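{- Let $h\ge2$, let $a/b$ be an $h$-Farey fraction with predecessor $a'/b'$, $\Delta\subset\mathbb N$ finite, $\tau,m$ integers, and let $S=S(h,a/b,\Delta,\tau,m)=\langle m,\Gamma\rangle_c$ satisfy the standing assumptions below. Assume $S$ is canonically defined and collision-free. Let $\ell$ be the number of left generators of $S$, $s_i=\left(\!\binom{\ell-1}{i}\!\right)$ for $i\ge0$, $s=\left(\!\binom{\ell}{h}\!\right)$, and let $\omega$ be the number of long elements, i.e. the number of pairs $(i,\lambda)$ with $0\le i\le h-1$ and $\lambda\in i\Gamma$ long. Then the Eliahou number of $S$ is $E=E_0+\rho+\ell\omega$, where $E_0$ admits the four equivalent expressions $E_0=-\ell\sum_{i=0}^{h-1}\phi'_{h-i}s_i+\phi'_h s$, $E_0=-(h-1)s_h+\ell\sum_{i=0}^{h-1}\phi_{h-i}s_i-\phi_h s$, $E_0=-\lfloor h\phi'_1\rfloor s+\ell\sum_{j=1}^{\lfloor h\phi'_1\rfloor}\left(\!\binom{\ell}{h-\lceil j/\phi'_1\rceil}\!\right)$, $E_0=-(h-1)s_h+\lfloor h\phi_1\rfloor s-\ell\sum_{j=1}^{\lfloor h\phi_1\rfloor}\left(\!\binom{\ell}{h-\lceil j/\phi_1\rceil}\!\right)$.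
   Context: For a positive integer $m$, a finite set $\Gamma$ of integers larger than $m$ and an integer $c>m$, $\langle m,\Gamma\rangle_c$ denotes the submonoid of $(\mathbb N,+)$ generated by $m$, the elements of $\Gamma$ and all integers $\ge c$. An element $x>0$ of such $S$ is primitive if it is not the sum of two nonzero elements of $S$; $S$ is canonically defined if $m$ and all elements of $\Gamma$ are primitive and $c-1\notin S$. Parameters (with respect to $c$): $k=|S\cap[0,c)|$; $\ell$ = number of primitive elements of $S$ below $c$ (left generators); $r$ = number of primitive elements of $S$ that are $\ge c$; $s_{\mathrm{crit}}=m-r$; $q=\lceil c/m\rceil$; $\rho=qm-c$; Eliahou number $E=k\ell+qr-c$. For a finite set $A$ and $i\ge0$, $iA=\{a_1+\dots+a_i:a_j\in A\}$ ($0A=\{0\}$). $\left(\!\binom{n}{i}\!\right)=\binom{n+i-1}{i}$. $\{x\}=x-\lfloor x\rfloor$. A finite $A\subset\mathbb Z$ is a $B_h$ set if $|hA|=\left(\!\binom{|A|}{h}\!\right)$. Let $h\ge2$. An $h$-Farey fraction is a reduced fraction $a/b$ with $a\in\mathbb Z$, $1\le b\le h$; its predecessor $a'/b'$ is the largest $h$-Farey fraction strictly less than $a/b$ (in lowest terms, $1\le b'\le h$). For a finite $\Delta\subset\mathbb N$ and integers $\tau,m$, $S(h,a/b,\Delta,\tau,m)=\langle m,\Gamma\rangle_c$ with $c=\lfloor ahm/b\rfloor-m-\tau$ and $\Gamma=\{\lfloor (c+m-1)/h\rfloor-\delta:\delta\in\Delta\}$. Put $\gamma_1=\min\Gamma$,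 $w=c+m-h\gamma_1$. Standing assumptions: all elements of $\Gamma$ exceed $m$; $m\ge w$ (equivalently $h\Gamma\subset[c,c+m)$); and $a'/b'<(c+m)/(hm)\le a/b$. For $1\le i\le h$, $\phi_i=\{ -ia/b\}$ and $\phi'_i=\{ia'/b'\}$. An element $\lambda\in i\Gamma$ with $0\le i\le h-1$ is short if $\lceil (c-\lambda)/m\rceil\ge\lfloor (h-i)a'/b'\rfloor$ and long otherwise. $S$ is collision-free if every element of $[c,c+m)$ can be written in a unique way as a combination of generators of $S$; equivalently, $\Gamma$ is a $B_h$ set and the sumsets $i\Gamma$, $0\le i\le h$, are pairwise disjoint modulo $m$.
   Formalization: An element λ∈iΓ is taken to be long when ⌈(c-λ)/m⌉ > ⌊(h-i)a'/b'⌋ and short when ≤; with the inequality as printed the formula fails (h=2, a/b=3, m=14, τ=5, Δ={6}: E=6, but E_0+ρ+ℓω=4). -}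

module Defs where

open import Data.Nat as ℕ using (ℕ; zero; suc)
open import Data.Nat.Combinatorics using (_C_)
open import Data.Nat.GCD using (gcd)
open import Data.Integer.Divisibility using (_∣_)
open import Data.Integer as ℤ using (ℤ; +_)
open import Data.Rational as ℚ using (ℚ; 0ℚ; floor; ceiling)
open import Data.Rational.Properties as ℚP using ()
open import Data.List using (List; []; _∷_; length; sum; map; upTo)
open import Data.List.Relation.Unary.All using (All)
open import Data.List.Relation.Unary.Unique.Propositional using (Unique)
open import Data.List.Membership.Propositional using (_∈_)
open import Data.Product using (Σ; _×_; _,_; ∃)
open import Data.Sum using (_⊎_)
open import Relation.Binary.PropositionalEquality using (_≡_; _≢_)
open import Relation.Nullary using (¬_; yes; no)
open import Function.Bundles using (_⇔_)

-- multiset coefficient ((n i)) = binom(n+i-1, i)  (with ((0 0)) = 1, ((0 i)) = 0 for i>0)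
mch : ℕ → ℕ → ℕ
mch n i = (n ℕ.+ i ℕ.∸ 1) C i

-- the rational x / d ; only used with d ≥ 1 (d = 0 gives 0, a junk value)
_//_ : ℤ → ℕ → ℚ
x // zero = 0ℚ
x // suc d = x ℚ./ suc d

toℚ : ℤ → ℚ
toℚ x = x ℚ./ 1

frac : ℚ → ℚ
frac x = x ℚ.- toℚ (floor x)

-- division of rationals; only used with nonzero divisor (junk value 0 otherwise)
_÷'_ : ℚ → ℚ → ℚ
p ÷' q with q ℚP.≟ 0ℚ
... | yes _ = 0ℚ
... | no q≢0 = ℚ._÷_ p q {{ℚ.≢-nonZero q≢0}}

Σℚ : List ℚ → ℚ
Σℚ [] = 0ℚ
Σℚ (x ∷ xs) = x ℚ.+ Σℚ xs

Σ<  : ℕ → (ℕ → ℚ) → ℚ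
Σ< n f = Σℚ (map f (upTo n))

Σ1to : ℕ → (ℕ → ℚ) → ℚ
Σ1to n f = Σℚ (map (λ i → f (suc i)) (upTo n))

record IsCard {A : Set} (P : A → Set) (n : ℕ) : Set where
  field
    elems    : List A
    unique   : Unique elems
    complete : ∀ x → (x ∈ elems) ⇔ P x
    size     : length elems ≡ n

IsFarey : ℕ → ℤ → ℕ → Set
IsFarey h a b = (1 ℕ.≤ b) × (b ℕ.≤ h) × (gcd ℤ.∣ a ∣ b ≡ 1)

IsPred : ℕ → ℤ → ℕ → ℤ → ℕ → Set
IsPred h a b a' b' =
  IsFarey h a' b' × (a' ℤ.* + b ℤ.< a ℤ.* + b')
  × (∀ x y → IsFarey h x y → x ℤ.* + b ℤ.< a ℤ.* + y → x ℤ.* + b' ℤ.≤ a' ℤ.* + y)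

-- The semigroup ⟨m,Γ⟩_c (as a predicate on ℤ; all its elements are ≥ 0)

sumℤ : List ℤ → ℤ
sumℤ [] = + 0
sumℤ (x ∷ xs) = x ℤ.+ sumℤ xs

Gen : ℕ → (ℤ → Set) → ℤ → ℤ → Set
Gen m Γ c x = (x ≡ + m) ⊎ Γ x ⊎ (c ℤ.≤ x)

InS : ℕ → (ℤ → Set) → ℤ → ℤ → Set
InS m Γ c x = Σ (List ℤ) λ gs → All (Gen m Γ c) gs × (sumℤ gs ≡ x)

Primitive : ℕ → (ℤ → Set) → ℤ → ℤ → Set
Primitive m Γ c x =
  (+ 0 ℤ.< x) × InS m Γ c x
  × ¬ (Σ ℤ λ y → Σ ℤ λ z → (+ 0 ℤ.< y) × (+ 0 ℤ.< z)
        × InS m Γ c y × InS m Γ c z × (x ≡ y ℤ.+ z))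

Canonical : ℕ → (ℤ → Set) → ℤ → Set
Canonical m Γ c =
  Primitive m Γ c (+ m) × (∀ γ → Γ γ → Primitive m Γ c γ)
  × ¬ InS m Γ c (c ℤ.- + 1)

Sumset : ℕ → (ℤ → Set) → ℤ → Set
Sumset i A x = Σ (List ℤ) λ xs → (length xs ≡ i) × All A xs × (sumℤ xs ≡ x)

IsBh : ℕ → (ℤ → Set) → Set
IsBh h A = ∀ n N → IsCard A n → IsCard (Sumset h A) N → N ≡ mch n h

CollisionFree : ℕ → ℕ → (ℤ → Set) → Set
CollisionFree h m Γ =
  IsBh h Γ
  × (∀ i j x y → i ℕ.≤ h → j ℕ.≤ h → i ≢ j →
       Sumset i Γ x → Sumset j Γ y → ¬ ((+ m) ∣ (x ℤ.- y)))

cOf : ℕ → ℤ → ℕ → ℤ → ℕ → ℤ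
cOf h a b τ m = floor ((a ℤ.* + h ℤ.* + m) // b) ℤ.- + m ℤ.- τ

GammaOf : ℕ → ℤ → ℕ → List ℕ → ℤ → Set
GammaOf h c m Δ γ =
  Σ ℕ λ δ → (δ ∈ Δ) × (γ ≡ floor ((c ℤ.+ + m ℤ.- + 1) // h) ℤ.- + δ)

IsLong : ℕ → ℤ → ℕ → ℤ → ℕ → (ℤ → Set) → ℕ × ℤ → Set
IsLong h a' b' c m Γ (i , λ') =
  (i ℕ.< h) × Sumset i Γ λ'
  × (floor ((+ (h ℕ.∸ i) ℤ.* a') // b') ℤ.< ceiling ((c ℤ.- λ') // m))

qOf : ℤ → ℕ → ℤ
qOf c m = ceiling (c // m)

ρOf : ℤ → ℕ → ℤ
ρOf c m = qOf c m ℤ.* + m ℤ.- c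

EOf : ℤ → ℕ → ℕ → ℕ → ℕ → ℤ
EOf c m k ℓ r = + (k ℕ.* ℓ) ℤ.+ qOf c m ℤ.* + r ℤ.- c

φ : ℤ → ℕ → ℕ → ℚ
φ a b i = frac ((ℤ.- (+ i ℤ.* a)) // b)

φ' : ℤ → ℕ → ℕ → ℚ
φ' a' b' i = frac ((+ i ℤ.* a') // b')

ℕℚ : ℕ → ℚ
ℕℚ n = toℚ (+ n)

E0-1 : ℕ → ℤ → ℕ → ℕ → ℚ
E0-1 h a' b' ℓ =
  ℚ.- (ℕℚ ℓ ℚ.* Σ< h (λ i → φ' a' b' (h ℕ.∸ i) ℚ.* ℕℚ (mch (ℓ ℕ.∸ 1) i)))
  ℚ.+ φ' a' b' h ℚ.* ℕℚ (mch ℓ h)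

E0-2 : ℕ → ℤ → ℕ → ℕ → ℚ
E0-2 h a b ℓ =
  ℚ.- (ℕℚ (h ℕ.∸ 1) ℚ.* ℕℚ (mch (ℓ ℕ.∸ 1) h))
  ℚ.+ ℕℚ ℓ ℚ.* Σ< h (λ i → φ a b (h ℕ.∸ i) ℚ.* ℕℚ (mch (ℓ ℕ.∸ 1) i))
  ℚ.- φ a b h ℚ.* ℕℚ (mch ℓ h)

-- ((ℓ, h - ⌈j/x⌉)) as a rational (h - ⌈j/x⌉ ≥ 0 in the range where it is used)
term : ℕ → ℕ → ℚ → ℕ → ℚ
term h ℓ x j = ℕℚ (mch ℓ ℤ.∣ + h ℤ.- ceiling (ℕℚ j ÷' x) ∣)

E0-3 : ℕ → ℤ → ℕ → ℕ → ℚ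
E0-3 h a' b' ℓ =
  let x = φ' a' b' 1 ; N = floor (ℕℚ h ℚ.* x) in
  ℚ.- (toℚ N ℚ.* ℕℚ (mch ℓ h))
  ℚ.+ ℕℚ ℓ ℚ.* Σ1to ℤ.∣ N ∣ (term h ℓ x)

E0-4 : ℕ → ℤ → ℕ → ℕ → ℚ
E0-4 h a b ℓ =
  let x = φ a b 1 ; N = floor (ℕℚ h ℚ.* x) in
  ℚ.- (ℕℚ (h ℕ.∸ 1) ℚ.* ℕℚ (mch (ℓ ℕ.∸ 1) h))
  ℚ.+ toℚ N ℚ.* ℕℚ (mch ℓ h)
  ℚ.- ℕℚ ℓ ℚ.* Σ1to ℤ.∣ N ∣ (term h ℓ x)

{-# OPTIONS --safe #-}

-- Multisets of size at most h in Γ are told apart modulo m by their sums, so every element of S below c is uniquely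
-- λ + j m with λ ∈ iΓ and i < h, and the non-primitive elements of [c, c + m) are exactly the
-- representatives of the classes λ with λ ∈ iΓ, i ≤ h. Hence r = m - s and k is the sum of ⌈(c - λ)/m⌉.
-- Since a'/b' and a/b are Farey neighbours, n a/b ≤ ⌊n a'/b'⌋ + 1 for n ≤ h, which pins ⌈(c - λ)/m⌉ to
-- ⌊(h-i) a'/b'⌋, plus one when λ is long, and q to ⌊h a'/b'⌋. This gives E = T(⌊n a'/b'⌋) + ρ + ℓω for
-- the linear functional T(f) = ℓ Σ_{i<h} f(h-i) s_i - f(h) s. As T kills f(n) = n and sends 1 to
-- (h-1) s_h, one may trade floors for fractional parts and a'/b' for a/b; the last two expressions
-- come from summing n ↦ ⌊n x⌋ by layers.

module Submission where

open import Defs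
open import Data.Nat as ℕ using (ℕ; zero; suc; z≤n; s≤s)
open import Data.Integer as ℤ using (ℤ; +_; -[1+_])
open import Data.Rational as ℚ using (ℚ; 0ℚ; 1ℚ; floor; ceiling; toℚᵘ; ↥_; ↧_; ↧ₙ_)
open import Data.List using (List; []; _∷_; _++_; [_]; concatMap; deduplicate; filter; length; map; upTo)
open import Data.Product using (Σ; ∃; _×_; _,_; proj₁; proj₂)
open import Relation.Binary.PropositionalEquality hiding ([_]; J)

open import Data.Integer.Divisibility using (_∣_)
import Data.Integer.DivMod as ℤD
import Data.Integer.GCD as ℤG
import Data.Integer.Properties as ℤP
open import Data.Integer.Tactic.RingSolver using () renaming (solve-∀ to ℤ-solve)
open import Data.List.Membership.DecPropositional ℤP._≟_ using (_∈?_)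
open import Data.List.Membership.Propositional using (_∈_; _∉_; find; lose)
open import Data.List.Membership.Propositional.Properties
open import Data.List.Membership.Propositional.Properties.WithK using (unique∧set⇒bag)
open import Data.List.Properties
  using (filter-notAll; length-++; length-filter; length-map; length-upTo; map-++; map-cong; upTo-∷ʳ)
open import Data.List.Relation.Binary.BagAndSetEquality using (∼bag⇒↭)
open import Data.List.Relation.Binary.Permutation.Propositional.Properties using (↭-length)
open import Data.List.Relation.Unary.All as All using (All; []; _∷_)
import Data.List.Relation.Unary.All.Properties as AllP
open import Data.List.Relation.Unary.AllPairs using ([]; _∷_)
open import Data.List.Relation.Unary.Any as Any using (Any; here; there)
open import Data.List.Relation.Unary.Unique.DecPropositional.Properties ℤP._≟_ using (deduplicate-!)
open import Data.List.Relation.Unary.Unique.Propositional using (Unique)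
import Data.List.Relation.Unary.Unique.Propositional.Properties as Unique
open import Data.Maybe using (Maybe; just; nothing)
open import Data.Nat.Combinatorics using (nCk+nC[k+1]≡[n+1]C[k+1]; k>n⇒nCk≡0)
import Data.Nat.Coprimality as Coprimality
import Data.Nat.Divisibility as ℕD
open import Data.Nat.GCD using (gcd)
open import Data.Nat.ListAction using (sum)
open import Data.Nat.ListAction.Properties using (sum-++)
import Data.Nat.Properties as ℕP
import Data.Rational.Properties as ℚP
import Data.Rational.Unnormalised as ℚᵘ
import Data.Rational.Unnormalised.Properties as ℚᵘP
open import Data.Sum using (_⊎_; inj₁; inj₂)
open import Function using (_∘_; const)
open import Function.Bundles using (_⇔_; mk⇔; Equivalence)
import Function.Properties.Equivalence as ⇔
open import Relation.Binary.Definitions using (DecidableEquality)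
open import Relation.Nullary using (¬_; ¬?; Dec; yes; no; contradiction)
open import Tactic.RingSolver using (solve-∀)
import Tactic.RingSolver.Core.AlmostCommutativeRing as ACR

-- Floors and ceilings of rationals

-- The hypotheses separate iΓ from jΓ modulo m only for i ≠ j. Within one iΓ the separation is a
-- matter of size: `c ≤ h γ < c + m` puts h λ between i c and i (c + m - 1) for every λ in iΓ, so
-- two elements of iΓ differ by less than m, and congruent means equal. That equal sums come from
-- equal multisets is assumed for size h only; adding a fixed element of Γ to both sides passes it
-- down to every i ≤ h. The same two bounds give, with n = h - i, n (c + m)/(h m) - 1 ≤ (c - λ)/m ≤
-- n (c + m)/(h m) - n/h. Since (c + m)/(h m) lies in (a'/b', a/b], only two values remain for the
-- ceiling. For i = 0 the term n/h is a full 1, and this is why q has no ambiguity. That T kills n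
-- is the identity ℓ Σ_{i<h} (h - i) s_i = h s, a form of absorption for multiset coefficients. The
-- s in T(f) and the s in r = m - s are the same number, Σ_{i≤h} s_i.

ℚ-ring : ACR.AlmostCommutativeRing _ _
ℚ-ring = ACR.fromCommutativeRing ℚP.+-*-commutativeRing 0≟
  where
  0≟ : ∀ x → Maybe (0ℚ ≡ x)
  0≟ x with 0ℚ ℚP.≟ x
  ... | yes e = just e
  ... | no _  = nothing

toℚᵘ-// : ∀ x d → toℚᵘ (x // suc d) ℚᵘ.≃ ℚᵘ.mkℚᵘ x d
toℚᵘ-// x d = ℚP.toℚᵘ-fromℚᵘ (ℚᵘ.mkℚᵘ x d)

//-mono : ∀ x y d e → x ℤ.* + suc e ℤ.≤ y ℤ.* + suc d → x // suc d ℚ.≤ y // suc e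
//-mono x y d e le = ℚP.toℚᵘ-cancel-≤
  (ℚᵘP.≤-respˡ-≃ (ℚᵘP.≃-sym (toℚᵘ-// x d)) (ℚᵘP.≤-respʳ-≃ (ℚᵘP.≃-sym (toℚᵘ-// y e)) (ℚᵘ.*≤* le)))

//-cancel : ∀ x y d e → x // suc d ℚ.≤ y // suc e → x ℤ.* + suc e ℤ.≤ y ℤ.* + suc d
//-cancel x y d e le = ℚᵘP.drop-*≤*
  (ℚᵘP.≤-respˡ-≃ (toℚᵘ-// x d) (ℚᵘP.≤-respʳ-≃ (toℚᵘ-// y e) (ℚP.toℚᵘ-mono-≤ le)))

toℚ-mono : ∀ x y → x ℤ.≤ y → toℚ x ℚ.≤ toℚ y
toℚ-mono x y le = //-mono x y 0 0 (ℤP.*-monoʳ-≤-nonNeg (+ 1) le)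

toℚ-cancel : ∀ x y → toℚ x ℚ.≤ toℚ y → x ℤ.≤ y
toℚ-cancel x y le = ℤP.*-cancelʳ-≤-pos x y (+ 1) (//-cancel x y 0 0 le)

toℚ-+ : ∀ x y → toℚ (x ℤ.+ y) ≡ toℚ x ℚ.+ toℚ y
toℚ-+ x y = ℚP.toℚᵘ-injective (begin
  toℚᵘ (toℚ (x ℤ.+ y))                  ≈⟨ toℚᵘ-// _ 0 ⟩
  ℚᵘ.mkℚᵘ (x ℤ.+ y) 0                   ≈⟨ ℚᵘ.*≡* (lem x y) ⟩
  ℚᵘ.mkℚᵘ x 0 ℚᵘ.+ ℚᵘ.mkℚᵘ y 0         ≈⟨ ℚᵘP.+-cong (toℚᵘ-// x 0) (toℚᵘ-// y 0) ⟨
  toℚᵘ (toℚ x) ℚᵘ.+ toℚᵘ (toℚ y)        ≈⟨ ℚP.toℚᵘ-homo-+ (toℚ x) (toℚ y) ⟨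
  toℚᵘ (toℚ x ℚ.+ toℚ y)                ∎)
  where
  open ℚᵘP.≃-Reasoning
  lem : ∀ x y → (x ℤ.+ y) ℤ.* + 1 ≡ (x ℤ.* + 1 ℤ.+ y ℤ.* + 1) ℤ.* + 1
  lem = ℤ-solve

toℚ-*-// : ∀ x y d → (x ℤ.* y) // suc d ≡ toℚ x ℚ.* (y // suc d)
toℚ-*-// x y d = ℚP.toℚᵘ-injective (begin
  toℚᵘ ((x ℤ.* y) // suc d)             ≈⟨ toℚᵘ-// _ d ⟩
  ℚᵘ.mkℚᵘ (x ℤ.* y) d                   ≈⟨ ℚᵘ.*≡* (cong (λ e → x ℤ.* y ℤ.* + e) (lem d)) ⟩
  ℚᵘ.mkℚᵘ x 0 ℚᵘ.* ℚᵘ.mkℚᵘ y d          ≈⟨ ℚᵘP.*-cong (toℚᵘ-// x 0) (toℚᵘ-// y d) ⟨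
  toℚᵘ (toℚ x) ℚᵘ.* toℚᵘ (y // suc d)   ≈⟨ ℚP.toℚᵘ-homo-* (toℚ x) (y // suc d) ⟨
  toℚᵘ (toℚ x ℚ.* (y // suc d))         ∎)
  where
  open ℚᵘP.≃-Reasoning
  lem : ∀ d → suc (d ℕ.+ 0) ≡ suc d
  lem d = cong suc (ℕP.+-identityʳ d)

toℚ-* : ∀ x y → toℚ (x ℤ.* y) ≡ toℚ x ℚ.* toℚ y
toℚ-* x y = toℚ-*-// x y 0

neg-// : ∀ x d → (ℤ.- x) // suc d ≡ ℚ.- (x // suc d)
neg-// x d = trans (cong (_// suc d) (lem x)) (trans (toℚ-*-// (ℤ.- + 1) x d) (lem′ _))
  where
  lem : ∀ x → ℤ.- x ≡ (ℤ.- + 1) ℤ.* x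
  lem = ℤ-solve
  lem′ : ∀ x → toℚ (ℤ.- + 1) ℚ.* x ≡ ℚ.- x
  lem′ = solve-∀ ℚ-ring

toℚ-neg : ∀ x → toℚ (ℤ.- x) ≡ ℚ.- toℚ x
toℚ-neg x = neg-// x 0

toℚ-- : ∀ x y → toℚ (x ℤ.- y) ≡ toℚ x ℚ.- toℚ y
toℚ-- x y = trans (toℚ-+ x (ℤ.- y)) (cong (toℚ x ℚ.+_) (toℚ-neg y))

<suc⇒≤ : ∀ {i j} → i ℤ.< ℤ.suc j → i ℤ.≤ j
<suc⇒≤ {i} {j} i<1+j = subst₂ ℤ._≤_ (ℤP.pred-suc i) (ℤP.pred-suc j) (ℤP.pred-mono (ℤP.i<j⇒suc[i]≤j i<1+j))

-- Together with `≤floor⁻` this is the adjunction between `toℚ` and `floor`. Integer division is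
-- opened only in these two proofs; all later facts on floors and ceilings go through the
-- adjunction.
≤floor : ∀ z p → toℚ z ℚ.≤ p → z ℤ.≤ floor p
≤floor z p@(ℚ.mkℚ n d-1 _) le = <suc⇒≤ (ℤP.*-cancelʳ-<-nonNeg (+ suc d-1)
   (ℤP.≤-<-trans le' (subst (λ t → n ℤ.< ℤ.suc t ℤ.* + suc d-1) (sym (ℤD.div-pos-is-/ℕ n (suc d-1))) (ℤD.n<s[n/ℕd]*d n (suc d-1)))))
  where
  le' : z ℤ.* + suc d-1 ℤ.≤ n
  le' = subst (z ℤ.* + suc d-1 ℤ.≤_) (ℤP.*-identityʳ n)
    (ℚᵘP.drop-*≤* (ℚᵘP.≤-respˡ-≃ (toℚᵘ-// z 0) (ℚP.toℚᵘ-mono-≤ le)))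

≤floor⁻ : ∀ z p → z ℤ.≤ floor p → toℚ z ℚ.≤ p
≤floor⁻ z p@(ℚ.mkℚ n d-1 _) le = ℚP.toℚᵘ-cancel-≤ (ℚᵘP.≤-respˡ-≃ (ℚᵘP.≃-sym (toℚᵘ-// z 0)) (ℚᵘ.*≤* le'))
  where
  le' : z ℤ.* + suc d-1 ℤ.≤ n ℤ.* + 1
  le' = subst (z ℤ.* + suc d-1 ℤ.≤_) (sym (ℤP.*-identityʳ n))
    (ℤP.≤-trans (ℤP.*-monoʳ-≤-nonNeg (+ suc d-1) le) (ℤD.[n/d]*d≤n n (+ suc d-1)))

≡floor : ∀ z p → toℚ z ℚ.≤ p → ¬ toℚ (ℤ.suc z) ℚ.≤ p → floor p ≡ z
≡floor z p le ¬le = ℤP.≤-antisym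
  (ℤP.≮⇒≥ λ lt → ¬le (≤floor⁻ _ p (ℤP.i<j⇒suc[i]≤j lt)))
  (≤floor z p le)

ceiling-neg : ∀ p → ceiling p ≡ ℤ.- floor (ℚ.- p)
ceiling-neg (ℚ.mkℚ _ _ _) = refl

ceiling≤ : ∀ z p → p ℚ.≤ toℚ z → ceiling p ℤ.≤ z
ceiling≤ z p le rewrite ceiling-neg p = subst (ℤ.- floor (ℚ.- p) ℤ.≤_) (ℤP.neg-involutive z)
  (ℤP.neg-mono-≤ (≤floor (ℤ.- z) (ℚ.- p) (subst (ℚ._≤ ℚ.- p) (sym (toℚ-neg z)) (ℚP.neg-antimono-≤ le))))

neg-involutive : ∀ p → ℚ.- (ℚ.- p) ≡ p
neg-involutive = solve-∀ ℚ-ring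

ceiling≤⁻ : ∀ z p → ceiling p ℤ.≤ z → p ℚ.≤ toℚ z
ceiling≤⁻ z p le rewrite ceiling-neg p = subst₂ ℚ._≤_ (neg-involutive p) (trans (cong ℚ.-_ (toℚ-neg z)) (neg-involutive _))
  (ℚP.neg-antimono-≤ (≤floor⁻ _ (ℚ.- p) (subst (ℤ.- z ℤ.≤_) (ℤP.neg-involutive (floor (ℚ.- p))) (ℤP.neg-mono-≤ le))))

≤floor-// : ∀ z x d → z ℤ.* + suc d ℤ.≤ x → z ℤ.≤ floor (x // suc d)
≤floor-// z x d le = ≤floor z _ (//-mono z x 0 d (subst (z ℤ.* + suc d ℤ.≤_) (sym (ℤP.*-identityʳ x)) le))

≤floor-//⁻ : ∀ z x d → z ℤ.≤ floor (x // suc d) → z ℤ.* + suc d ℤ.≤ x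
≤floor-//⁻ z x d le = subst (z ℤ.* + suc d ℤ.≤_) (ℤP.*-identityʳ x) (//-cancel z x 0 d (≤floor⁻ z _ le))

ceiling-//≤ : ∀ z x d → x ℤ.≤ z ℤ.* + suc d → ceiling (x // suc d) ℤ.≤ z
ceiling-//≤ z x d le = ceiling≤ z _ (//-mono x z d 0 (subst (ℤ._≤ z ℤ.* + suc d) (sym (ℤP.*-identityʳ x)) le))

ceiling-//≤⁻ : ∀ z x d → ceiling (x // suc d) ℤ.≤ z → x ℤ.≤ z ℤ.* + suc d
ceiling-//≤⁻ z x d le = subst (ℤ._≤ z ℤ.* + suc d) (ℤP.*-identityʳ x) (//-cancel x z d 0 (ceiling≤⁻ z _ le))

floor-≤ : ∀ p → toℚ (floor p) ℚ.≤ p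
floor-≤ p = ≤floor⁻ _ p ℤP.≤-refl

floor-+ : ∀ z p → floor (toℚ z ℚ.+ p) ≡ z ℤ.+ floor p
floor-+ z p = ≡floor _ _
  (subst (ℚ._≤ toℚ z ℚ.+ p) (sym (toℚ-+ z (floor p))) (ℚP.+-monoʳ-≤ (toℚ z) (floor-≤ p)))
  λ le → ℤP.<-irrefl refl (ℤP.suc[i]≤j⇒i<j (≤floor _ p
     (subst₂ ℚ._≤_ (trans (cong (ℚ.- toℚ z ℚ.+_) (trans (cong toℚ (lem z (floor p))) (toℚ-+ z _))) (cancel (toℚ z) _)) (cancel (toℚ z) p)
       (ℚP.+-monoʳ-≤ (ℚ.- toℚ z) le))))
  where
  cancel : ∀ x y → ℚ.- x ℚ.+ (x ℚ.+ y) ≡ y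
  cancel = solve-∀ ℚ-ring
  lem : ∀ x y → + 1 ℤ.+ (x ℤ.+ y) ≡ x ℤ.+ (+ 1 ℤ.+ y)
  lem = ℤ-solve

0≤frac : ∀ p → 0ℚ ℚ.≤ frac p
0≤frac p = subst (ℚ._≤ frac p) (ℚP.+-inverseʳ (toℚ (floor p))) (ℚP.+-monoˡ-≤ (ℚ.- toℚ (floor p)) (floor-≤ p))

-- The integer n ⌊p⌋ can be pulled out of the floor. Only multiples of `frac p` remain, which is why
-- the last two expressions for E₀ involve nothing but φ'_1 or φ_1.
frac-*-frac : ∀ n p → frac (ℕℚ n ℚ.* p) ≡ ℕℚ n ℚ.* frac p ℚ.- toℚ (floor (ℕℚ n ℚ.* frac p))
frac-*-frac n p = begin
  N ℚ.* p ℚ.- toℚ (floor (N ℚ.* p))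
    ≡⟨ cong (λ y → N ℚ.* p ℚ.- toℚ (floor y)) split ⟩
  N ℚ.* p ℚ.- toℚ (floor (toℚ Z ℚ.+ N ℚ.* frac p))
    ≡⟨ cong (λ y → N ℚ.* p ℚ.- toℚ y) (floor-+ Z _) ⟩
  N ℚ.* p ℚ.- toℚ (Z ℤ.+ W)
    ≡⟨ cong (λ y → N ℚ.* p ℚ.- y) (trans (toℚ-+ Z W) (cong (ℚ._+ toℚ W) (toℚ-* (+ n) (floor p)))) ⟩
  N ℚ.* p ℚ.- (N ℚ.* toℚ (floor p) ℚ.+ toℚ W)
    ≡⟨ rearr N p (toℚ (floor p)) (toℚ W) ⟩
  N ℚ.* frac p ℚ.- toℚ W ∎
  where
  open ≡-Reasoning
  N : ℚ
  N = ℕℚ n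
  Z W : ℤ
  Z = + n ℤ.* floor p
  W = floor (N ℚ.* frac p)
  rearr : ∀ N p f w → N ℚ.* p ℚ.- (N ℚ.* f ℚ.+ w) ≡ N ℚ.* (p ℚ.- f) ℚ.- w
  rearr = solve-∀ ℚ-ring
  split′ : ∀ N p f → N ℚ.* p ≡ N ℚ.* f ℚ.+ N ℚ.* (p ℚ.- f)
  split′ = solve-∀ ℚ-ring
  split : N ℚ.* p ≡ toℚ Z ℚ.+ N ℚ.* frac p
  split = trans (split′ N p (toℚ (floor p))) (cong (ℚ._+ N ℚ.* frac p) (sym (toℚ-* (+ n) (floor p))))

÷'-*-cancel : ∀ p {x} → x ≢ 0ℚ → (p ÷' x) ℚ.* x ≡ p
÷'-*-cancel p {x} x≢0 with x ℚP.≟ 0ℚ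
... | yes e = contradiction e x≢0
... | no ≢0 = trans (ℚP.*-assoc p _ x) (trans (cong (p ℚ.*_) (ℚP.*-inverseˡ x {{ℚ.≢-nonZero ≢0}})) (ℚP.*-identityʳ p))

ceiling-÷'≤ : ∀ p x z .{{_ : ℚ.Positive x}} → p ℚ.≤ toℚ z ℚ.* x → ceiling (p ÷' x) ℤ.≤ z
ceiling-÷'≤ p x z le = ceiling≤ z (p ÷' x) (ℚP.*-cancelʳ-≤-pos {p ÷' x} x
  (subst (ℚ._≤ toℚ z ℚ.* x) (sym (÷'-*-cancel p (≢-sym (ℚP.<⇒≢ (ℚP.positive⁻¹ x))))) le))

ceiling-÷'≤⁻ : ∀ p x z .{{_ : ℚ.Positive x}} → ceiling (p ÷' x) ℤ.≤ z → p ℚ.≤ toℚ z ℚ.* x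
ceiling-÷'≤⁻ p x z le = subst (ℚ._≤ toℚ z ℚ.* x) (÷'-*-cancel p (≢-sym (ℚP.<⇒≢ (ℚP.positive⁻¹ x))))
  (ℚP.*-monoʳ-≤-nonNeg x {{ℚP.pos⇒nonNeg x}} {p ÷' x} (ceiling≤⁻ z (p ÷' x) le))

-- Multiset coefficients and the functional T

mch-zeroˡ : ∀ i → mch 0 (suc i) ≡ 0
mch-zeroˡ i = k>n⇒nCk≡0 (ℕP.n<1+n i)

mch-suc-suc : ∀ n i → mch (suc n) (suc i) ≡ mch (suc n) i ℕ.+ mch n (suc i)
mch-suc-suc n i rewrite ℕP.+-suc n i = sym (nCk+nC[k+1]≡[n+1]C[k+1] (n ℕ.+ i) i)

mutual
  -- The two absorption rules share the right-hand side, so once both hold at (n, i), Pascal's rule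
  -- gives the one at (n + 1, i) and the other at (n, i + 1). Hence the joint induction.
  mch-absorbʳ : ∀ n i → suc i ℕ.* mch n (suc i) ≡ (n ℕ.+ i) ℕ.* mch n i
  mch-absorbʳ zero zero = refl
  mch-absorbʳ zero (suc i) rewrite mch-zeroˡ i | mch-zeroˡ (suc i) = trans (ℕP.*-zeroʳ i) (sym (ℕP.*-zeroʳ i))
  mch-absorbʳ (suc n) i = begin
    suc i ℕ.* mch (suc n) (suc i)                             ≡⟨ cong (suc i ℕ.*_) (mch-suc-suc n i) ⟩
    suc i ℕ.* (mch (suc n) i ℕ.+ mch n (suc i))               ≡⟨ ℕP.*-distribˡ-+ (suc i) (mch (suc n) i) _ ⟩
    suc i ℕ.* mch (suc n) i ℕ.+ suc i ℕ.* mch n (suc i)       ≡⟨ cong (suc i ℕ.* mch (suc n) i ℕ.+_) (trans (mch-absorbʳ n i) (sym (mch-absorbˡ n i))) ⟩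
    suc i ℕ.* mch (suc n) i ℕ.+ n ℕ.* mch (suc n) i           ≡⟨ ℕP.*-distribʳ-+ (mch (suc n) i) (suc i) n ⟨
    (suc i ℕ.+ n) ℕ.* mch (suc n) i                           ≡⟨ cong (ℕ._* mch (suc n) i) (cong suc (ℕP.+-comm i n)) ⟩
    (suc n ℕ.+ i) ℕ.* mch (suc n) i                           ∎
    where open ≡-Reasoning

  mch-absorbˡ : ∀ n i → n ℕ.* mch (suc n) i ≡ (n ℕ.+ i) ℕ.* mch n i
  mch-absorbˡ n zero = cong (ℕ._* 1) (sym (ℕP.+-identityʳ n))
  mch-absorbˡ n (suc i) = begin
    n ℕ.* mch (suc n) (suc i)                                 ≡⟨ cong (n ℕ.*_) (mch-suc-suc n i) ⟩
    n ℕ.* (mch (suc n) i ℕ.+ mch n (suc i))                   ≡⟨ ℕP.*-distribˡ-+ n (mch (suc n) i) _ ⟩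
    n ℕ.* mch (suc n) i ℕ.+ n ℕ.* mch n (suc i)               ≡⟨ cong (ℕ._+ n ℕ.* mch n (suc i)) (trans (mch-absorbˡ n i) (sym (mch-absorbʳ n i))) ⟩
    suc i ℕ.* mch n (suc i) ℕ.+ n ℕ.* mch n (suc i)           ≡⟨ ℕP.*-distribʳ-+ (mch n (suc i)) (suc i) n ⟨
    (suc i ℕ.+ n) ℕ.* mch n (suc i)                           ≡⟨ cong (ℕ._* mch n (suc i)) (ℕP.+-comm (suc i) n) ⟩
    (n ℕ.+ suc i) ℕ.* mch n (suc i)                           ∎
    where open ≡-Reasoning

-- Finite sums of rationals and the functional T

ℕℚ-+ : ∀ x y → ℕℚ (x ℕ.+ y) ≡ ℕℚ x ℚ.+ ℕℚ y
ℕℚ-+ x y = toℚ-+ (+ x) (+ y)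

ℕℚ-* : ∀ x y → ℕℚ (x ℕ.* y) ≡ ℕℚ x ℚ.* ℕℚ y
ℕℚ-* x y = trans (cong toℚ (ℤP.pos-* x y)) (toℚ-* (+ x) (+ y))

Σℚ-++ : ∀ xs ys → Σℚ (xs ++ ys) ≡ Σℚ xs ℚ.+ Σℚ ys
Σℚ-++ [] ys = sym (ℚP.+-identityˡ (Σℚ ys))
Σℚ-++ (x ∷ xs) ys = trans (cong (x ℚ.+_) (Σℚ-++ xs ys)) (sym (ℚP.+-assoc x (Σℚ xs) (Σℚ ys)))

Σ<-suc : ∀ n f → Σ< (suc n) f ≡ Σ< n f ℚ.+ f n
Σ<-suc n f = begin
  Σℚ (map f (upTo (suc n)))            ≡⟨ cong (Σℚ ∘ map f) (upTo-∷ʳ n) ⟨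
  Σℚ (map f (upTo n ++ [ n ]))         ≡⟨ cong Σℚ (map-++ f (upTo n) [ n ]) ⟩
  Σℚ (map f (upTo n) ++ [ f n ])       ≡⟨ Σℚ-++ (map f (upTo n)) [ f n ] ⟩
  Σ< n f ℚ.+ (f n ℚ.+ 0ℚ)              ≡⟨ cong (Σ< n f ℚ.+_) (ℚP.+-identityʳ (f n)) ⟩
  Σ< n f ℚ.+ f n                       ∎
  where open ≡-Reasoning

Σ<-cong : ∀ n {f g} → (∀ i → i ℕ.< n → f i ≡ g i) → Σ< n f ≡ Σ< n g
Σ<-cong zero eq = refl
Σ<-cong (suc n) {f} {g} eq = begin
  Σ< (suc n) f      ≡⟨ Σ<-suc n f ⟩
  Σ< n f ℚ.+ f n    ≡⟨ cong₂ ℚ._+_ (Σ<-cong n (λ i i<n → eq i (ℕP.m<n⇒m<1+n i<n))) (eq n (ℕP.n<1+n n)) ⟩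
  Σ< n g ℚ.+ g n    ≡⟨ Σ<-suc n g ⟨
  Σ< (suc n) g      ∎
  where open ≡-Reasoning

Σ<-+ : ∀ n f g → Σ< n (λ i → f i ℚ.+ g i) ≡ Σ< n f ℚ.+ Σ< n g
Σ<-+ zero f g = refl
Σ<-+ (suc n) f g = begin
  Σ< (suc n) (λ i → f i ℚ.+ g i)                    ≡⟨ Σ<-suc n _ ⟩
  Σ< n (λ i → f i ℚ.+ g i) ℚ.+ (f n ℚ.+ g n)        ≡⟨ cong (ℚ._+ (f n ℚ.+ g n)) (Σ<-+ n f g) ⟩
  Σ< n f ℚ.+ Σ< n g ℚ.+ (f n ℚ.+ g n)               ≡⟨ interchange (Σ< n f) (Σ< n g) (f n) (g n) ⟩
  (Σ< n f ℚ.+ f n) ℚ.+ (Σ< n g ℚ.+ g n)             ≡⟨ cong₂ ℚ._+_ (Σ<-suc n f) (Σ<-suc n g) ⟨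
  Σ< (suc n) f ℚ.+ Σ< (suc n) g                     ∎
  where
  open ≡-Reasoning
  interchange : ∀ a b c d → a ℚ.+ b ℚ.+ (c ℚ.+ d) ≡ (a ℚ.+ c) ℚ.+ (b ℚ.+ d)
  interchange = solve-∀ ℚ-ring

Σ<-* : ∀ n c f → Σ< n (λ i → c ℚ.* f i) ≡ c ℚ.* Σ< n f
Σ<-* zero c f = sym (ℚP.*-zeroʳ c)
Σ<-* (suc n) c f = begin
  Σ< (suc n) (λ i → c ℚ.* f i)                ≡⟨ Σ<-suc n _ ⟩
  Σ< n (λ i → c ℚ.* f i) ℚ.+ c ℚ.* f n        ≡⟨ cong (ℚ._+ c ℚ.* f n) (Σ<-* n c f) ⟩
  c ℚ.* Σ< n f ℚ.+ c ℚ.* f n                  ≡⟨ ℚP.*-distribˡ-+ c (Σ< n f) (f n) ⟨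
  c ℚ.* (Σ< n f ℚ.+ f n)                      ≡⟨ cong (c ℚ.*_) (Σ<-suc n f) ⟨
  c ℚ.* Σ< (suc n) f                          ∎
  where open ≡-Reasoning

-- A multiset of size n on p + 1 letters is a multiset of size at most n on p letters, filled up
-- with the last letter.
Σ<-mch : ∀ p n → Σ< (suc n) (λ i → ℕℚ (mch p i)) ≡ ℕℚ (mch (suc p) n)
Σ<-mch p zero = refl
Σ<-mch p (suc n) = begin
  Σ< (suc (suc n)) s                             ≡⟨ Σ<-suc (suc n) s ⟩
  Σ< (suc n) s ℚ.+ s (suc n)                     ≡⟨ cong (ℚ._+ s (suc n)) (Σ<-mch p n) ⟩
  ℕℚ (mch (suc p) n) ℚ.+ s (suc n)               ≡⟨ ℕℚ-+ (mch (suc p) n) (mch p (suc n)) ⟨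
  ℕℚ (mch (suc p) n ℕ.+ mch p (suc n))           ≡⟨ cong ℕℚ (mch-suc-suc p n) ⟨
  ℕℚ (mch (suc p) (suc n))                       ∎
  where
  open ≡-Reasoning
  s : ℕ → ℚ
  s i = ℕℚ (mch p i)

-- All four expressions for E₀ are values of this functional, up to sign and the summand (h - 1) s_h.
T : ℕ → ℕ → (ℕ → ℚ) → ℚ
T p h f = ℕℚ (suc p) ℚ.* Σ< h (λ i → f (h ℕ.∸ i) ℚ.* ℕℚ (mch p i)) ℚ.- f h ℚ.* ℕℚ (mch (suc p) h)

T-cong : ∀ p h .{{_ : ℕ.NonZero h}} {f g} → (∀ n → 1 ℕ.≤ n → n ℕ.≤ h → f n ≡ g n) → T p h f ≡ T p h g
T-cong p h@(suc _) eq = cong₂ (λ x y → ℕℚ (suc p) ℚ.* x ℚ.- y ℚ.* ℕℚ (mch (suc p) h))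
  (Σ<-cong h λ i i<h → cong (ℚ._* ℕℚ (mch p i)) (eq (h ℕ.∸ i) (ℕP.m<n⇒0<n∸m i<h) (ℕP.m∸n≤m h i)))
  (eq h (s≤s z≤n) ℕP.≤-refl)

T-+ : ∀ p h f g → T p h (λ n → f n ℚ.+ g n) ≡ T p h f ℚ.+ T p h g
T-+ p h f g = trans
  (cong (λ x → ℕℚ (suc p) ℚ.* x ℚ.- (f h ℚ.+ g h) ℚ.* ℕℚ (mch (suc p) h))
    (trans (Σ<-cong h λ i _ → ℚP.*-distribʳ-+ (ℕℚ (mch p i)) (f (h ℕ.∸ i)) (g (h ℕ.∸ i))) (Σ<-+ h (λ i → f (h ℕ.∸ i) ℚ.* ℕℚ (mch p i)) (λ i → g (h ℕ.∸ i) ℚ.* ℕℚ (mch p i)))))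
  (lem (ℕℚ (suc p)) (Σ< h (λ i → f (h ℕ.∸ i) ℚ.* ℕℚ (mch p i))) (Σ< h (λ i → g (h ℕ.∸ i) ℚ.* ℕℚ (mch p i))) (f h) (g h) (ℕℚ (mch (suc p) h)))
  where
  lem : ∀ l x y u v s → l ℚ.* (x ℚ.+ y) ℚ.- (u ℚ.+ v) ℚ.* s ≡ (l ℚ.* x ℚ.- u ℚ.* s) ℚ.+ (l ℚ.* y ℚ.- v ℚ.* s)
  lem = solve-∀ ℚ-ring

T-* : ∀ p h c f → T p h (λ n → c ℚ.* f n) ≡ c ℚ.* T p h f
T-* p h c f = trans
  (cong (λ x → ℕℚ (suc p) ℚ.* x ℚ.- (c ℚ.* f h) ℚ.* ℕℚ (mch (suc p) h))
    (trans (Σ<-cong h λ i _ → ℚP.*-assoc c (f (h ℕ.∸ i)) (ℕℚ (mch p i))) (Σ<-* h c (λ i → f (h ℕ.∸ i) ℚ.* ℕℚ (mch p i)))))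
  (lem (ℕℚ (suc p)) (Σ< h (λ i → f (h ℕ.∸ i) ℚ.* ℕℚ (mch p i))) c (f h) (ℕℚ (mch (suc p) h)))
  where
  lem : ∀ l x c u s → l ℚ.* (c ℚ.* x) ℚ.- (c ℚ.* u) ℚ.* s ≡ c ℚ.* (l ℚ.* x ℚ.- u ℚ.* s)
  lem = solve-∀ ℚ-ring

-- Raising h by one increases every weight by one and so adds a full sum Σ_{i≤h} s_i, which is
-- `mch (suc p) h`. The factor becomes ℓ + h, and absorption turns it into the claim at h + 1.
Σ<-weighted-mch : ∀ p h → ℕℚ (suc p) ℚ.* Σ< h (λ i → ℕℚ (h ℕ.∸ i) ℚ.* ℕℚ (mch p i)) ≡ ℕℚ h ℚ.* ℕℚ (mch (suc p) h)
Σ<-weighted-mch p zero = trans (ℚP.*-zeroʳ (ℕℚ (suc p))) (sym (ℚP.*-zeroˡ (ℕℚ (mch (suc p) 0))))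
Σ<-weighted-mch p (suc h) = begin
  L ℚ.* Σ< (suc h) (λ i → ℕℚ (suc h ℕ.∸ i) ℚ.* s i)
    ≡⟨ cong (L ℚ.*_) (Σ<-cong (suc h) λ { i (s≤s i≤h) → step i i≤h }) ⟩
  L ℚ.* Σ< (suc h) (λ i → ℕℚ (h ℕ.∸ i) ℚ.* s i ℚ.+ s i)
    ≡⟨ cong (L ℚ.*_) (Σ<-+ (suc h) (λ i → ℕℚ (h ℕ.∸ i) ℚ.* s i) s) ⟩
  L ℚ.* (Σ< (suc h) (λ i → ℕℚ (h ℕ.∸ i) ℚ.* s i) ℚ.+ Σ< (suc h) s)
    ≡⟨ cong₂ (λ x y → L ℚ.* (x ℚ.+ y)) drop (Σ<-mch p h) ⟩
  L ℚ.* (W ℚ.+ S)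
    ≡⟨ ℚP.*-distribˡ-+ L W S ⟩
  L ℚ.* W ℚ.+ L ℚ.* S
    ≡⟨ cong (ℚ._+ L ℚ.* S) (Σ<-weighted-mch p h) ⟩
  ℕℚ h ℚ.* S ℚ.+ L ℚ.* S
    ≡⟨ lem (ℕℚ h) L S ⟩
  (L ℚ.+ ℕℚ h) ℚ.* S
    ≡⟨ cong (ℚ._* S) (ℕℚ-+ (suc p) h) ⟨
  ℕℚ (suc p ℕ.+ h) ℚ.* S
    ≡⟨ ℕℚ-* (suc p ℕ.+ h) (mch (suc p) h) ⟨
  ℕℚ ((suc p ℕ.+ h) ℕ.* mch (suc p) h)
    ≡⟨ cong ℕℚ (mch-absorbʳ (suc p) h) ⟨
  ℕℚ (suc h ℕ.* mch (suc p) (suc h))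
    ≡⟨ ℕℚ-* (suc h) (mch (suc p) (suc h)) ⟩
  ℕℚ (suc h) ℚ.* ℕℚ (mch (suc p) (suc h)) ∎
  where
  open ≡-Reasoning
  s : ℕ → ℚ
  s i = ℕℚ (mch p i)
  L S W : ℚ
  L = ℕℚ (suc p)
  S = ℕℚ (mch (suc p) h)
  W = Σ< h (λ i → ℕℚ (h ℕ.∸ i) ℚ.* s i)
  lem : ∀ h L S → h ℚ.* S ℚ.+ L ℚ.* S ≡ (L ℚ.+ h) ℚ.* S
  lem = solve-∀ ℚ-ring
  lem′ : ∀ x s → (1ℚ ℚ.+ x) ℚ.* s ≡ x ℚ.* s ℚ.+ s
  lem′ = solve-∀ ℚ-ring
  step : ∀ i → i ℕ.≤ h → ℕℚ (suc h ℕ.∸ i) ℚ.* s i ≡ ℕℚ (h ℕ.∸ i) ℚ.* s i ℚ.+ s i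
  step i i≤h = trans (cong (ℚ._* s i) (trans (cong ℕℚ (ℕP.+-∸-assoc 1 i≤h)) (ℕℚ-+ 1 (h ℕ.∸ i)))) (lem′ (ℕℚ (h ℕ.∸ i)) (s i))
  drop : Σ< (suc h) (λ i → ℕℚ (h ℕ.∸ i) ℚ.* s i) ≡ W
  drop = begin
    Σ< (suc h) (λ i → ℕℚ (h ℕ.∸ i) ℚ.* s i)   ≡⟨ Σ<-suc h _ ⟩
    W ℚ.+ ℕℚ (h ℕ.∸ h) ℚ.* s h                ≡⟨ cong (λ k → W ℚ.+ ℕℚ k ℚ.* s h) (ℕP.n∸n≡0 h) ⟩
    W ℚ.+ 0ℚ ℚ.* s h                          ≡⟨ cong (W ℚ.+_) (ℚP.*-zeroˡ (s h)) ⟩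
    W ℚ.+ 0ℚ                                  ≡⟨ ℚP.+-identityʳ W ⟩
    W                                         ∎

T-id : ∀ p h → T p h ℕℚ ≡ 0ℚ
T-id p h = trans (cong (ℚ._- R) (Σ<-weighted-mch p h)) (ℚP.+-inverseʳ R)
  where
  R : ℚ
  R = ℕℚ h ℚ.* ℕℚ (mch (suc p) h)

-- With ℓ = p + 1 and s = `mch ℓ (h - 1)` + s_h the value is p times `mch ℓ (h - 1)`, minus s_h.
-- Absorption makes the first term h s_h. This is the origin of (h - 1) s_h in the second and fourth
-- expressions.
T-1 : ∀ p h .{{_ : ℕ.NonZero h}} → T p h (const 1ℚ) ≡ ℕℚ (h ℕ.∸ 1) ℚ.* ℕℚ (mch p h)
T-1 p (suc g) = begin
  ℕℚ (suc p) ℚ.* Σ< (suc g) (λ i → 1ℚ ℚ.* s i) ℚ.- 1ℚ ℚ.* ℕℚ (mch (suc p) (suc g))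
    ≡⟨ cong₂ (λ x y → x ℚ.* Σ< (suc g) (λ i → 1ℚ ℚ.* s i) ℚ.- 1ℚ ℚ.* y) (ℕℚ-+ 1 p)
         (trans (cong ℕℚ (mch-suc-suc p g)) (ℕℚ-+ (mch (suc p) g) (mch p (suc g)))) ⟩
  (1ℚ ℚ.+ P) ℚ.* Σ< (suc g) (λ i → 1ℚ ℚ.* s i) ℚ.- 1ℚ ℚ.* (S ℚ.+ s (suc g))
    ≡⟨ cong (λ x → (1ℚ ℚ.+ P) ℚ.* x ℚ.- 1ℚ ℚ.* (S ℚ.+ s (suc g))) (trans (Σ<-cong (suc g) λ i _ → ℚP.*-identityˡ (s i)) (Σ<-mch p g)) ⟩
  (1ℚ ℚ.+ P) ℚ.* S ℚ.- 1ℚ ℚ.* (S ℚ.+ s (suc g))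
    ≡⟨ lem P S (s (suc g)) ⟩
  P ℚ.* S ℚ.- s (suc g)
    ≡⟨ cong (ℚ._- s (suc g)) absorb ⟩
  (1ℚ ℚ.+ ℕℚ g) ℚ.* s (suc g) ℚ.- s (suc g)
    ≡⟨ lem′ (ℕℚ g) (s (suc g)) ⟩
  ℕℚ g ℚ.* s (suc g) ∎
  where
  open ≡-Reasoning
  s : ℕ → ℚ
  s i = ℕℚ (mch p i)
  P S : ℚ
  P = ℕℚ p
  S = ℕℚ (mch (suc p) g)
  lem : ∀ P S s → (1ℚ ℚ.+ P) ℚ.* S ℚ.- 1ℚ ℚ.* (S ℚ.+ s) ≡ P ℚ.* S ℚ.- s
  lem = solve-∀ ℚ-ring
  lem′ : ∀ g s → (1ℚ ℚ.+ g) ℚ.* s ℚ.- s ≡ g ℚ.* s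
  lem′ = solve-∀ ℚ-ring
  absorb : P ℚ.* S ≡ (1ℚ ℚ.+ ℕℚ g) ℚ.* s (suc g)
  absorb = begin
    P ℚ.* S                            ≡⟨ ℕℚ-* p (mch (suc p) g) ⟨
    ℕℚ (p ℕ.* mch (suc p) g)           ≡⟨ cong ℕℚ (trans (mch-absorbˡ p g) (sym (mch-absorbʳ p g))) ⟩
    ℕℚ (suc g ℕ.* mch p (suc g))       ≡⟨ ℕℚ-* (suc g) (mch p (suc g)) ⟩
    ℕℚ (suc g) ℚ.* s (suc g)           ≡⟨ cong (ℚ._* s (suc g)) (ℕℚ-+ 1 g) ⟩
    (1ℚ ℚ.+ ℕℚ g) ℚ.* s (suc g)        ∎

-- Summation by layers

𝟙 : {P : Set} → Dec P → ℚ
𝟙 (yes _) = 1ℚ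
𝟙 (no _)  = 0ℚ

𝟙-cong : {P Q : Set} (P? : Dec P) (Q? : Dec Q) → P ⇔ Q → 𝟙 P? ≡ 𝟙 Q?
𝟙-cong (yes p) (yes q) _ = refl
𝟙-cong (yes p) (no ¬q) e = contradiction (Equivalence.to e p) ¬q
𝟙-cong (no ¬p) (yes q) e = contradiction (Equivalence.from e q) ¬p
𝟙-cong (no ¬p) (no ¬q) _ = refl

-- Layer `suc m` counts exactly when it lies below `n`. The cap is the induction variable of
-- `Σ<-layers`.
ℕℚ-suc-⊓ : ∀ m n → ℕℚ (suc m ℕ.⊓ n) ≡ ℕℚ (m ℕ.⊓ n) ℚ.+ 𝟙 (suc m ℕ.≤? n)
ℕℚ-suc-⊓ m n with suc m ℕ.≤? n
... | yes m<n = trans (cong ℕℚ (trans (ℕP.m≤n⇒m⊓n≡m m<n) (sym (trans (ℕP.+-comm (m ℕ.⊓ n) 1) (cong suc (ℕP.m≤n⇒m⊓n≡m (ℕP.<⇒≤ m<n)))))))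
                  (ℕℚ-+ (m ℕ.⊓ n) 1)
... | no m≮n = trans (cong ℕℚ (trans (ℕP.m≥n⇒m⊓n≡n (ℕP.m≤n⇒m≤1+n n≤m)) (sym (ℕP.m≥n⇒m⊓n≡n n≤m)))) (sym (ℚP.+-identityʳ _))
  where
  n≤m : n ℕ.≤ m
  n≤m = ℕP.≮⇒≥ m≮n

Σ<-𝟙 : ∀ n e (f : ℕ → ℚ) → e ℕ.≤ n → Σ< n (λ i → 𝟙 (suc i ℕ.≤? e) ℚ.* f i) ≡ Σ< e f
Σ<-𝟙 n e f e≤n with ℕP.m≤n⇒m<n∨m≡n e≤n
Σ<-𝟙 (suc n) e f e≤n | inj₁ (s≤s e≤n′) = begin
  Σ< (suc n) F                                            ≡⟨ Σ<-suc n F ⟩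
  Σ< n F ℚ.+ 𝟙 (suc n ℕ.≤? e) ℚ.* f n                     ≡⟨ cong₂ ℚ._+_ (Σ<-𝟙 n e f e≤n′) (cong (ℚ._* f n) (𝟙-no (suc n ℕ.≤? e))) ⟩
  Σ< e f ℚ.+ 0ℚ ℚ.* f n                                   ≡⟨ cong (Σ< e f ℚ.+_) (ℚP.*-zeroˡ (f n)) ⟩
  Σ< e f ℚ.+ 0ℚ                                           ≡⟨ ℚP.+-identityʳ _ ⟩
  Σ< e f                                                  ∎
  where
  open ≡-Reasoning
  F : ℕ → ℚ
  F i = 𝟙 (suc i ℕ.≤? e) ℚ.* f i
  𝟙-no : (d : Dec (suc n ℕ.≤ e)) → 𝟙 d ≡ 0ℚ
  𝟙-no (yes n<e) = contradiction n<e (ℕP.≤⇒≯ e≤n′)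
  𝟙-no (no _) = refl
Σ<-𝟙 n .n f e≤n | inj₂ refl = Σ<-cong n λ i i<n → trans (cong (ℚ._* f i) (𝟙-yes i i<n (suc i ℕ.≤? n))) (ℚP.*-identityˡ (f i))
  where
  𝟙-yes : ∀ i → i ℕ.< n → (d : Dec (suc i ℕ.≤ n)) → 𝟙 d ≡ 1ℚ
  𝟙-yes i i<n (yes _) = refl
  𝟙-yes i i<n (no i≮n) = contradiction i<n i≮n

-- g n counts the thresholds C 1, C 2, … that are at most n, and the sum is taken threshold by threshold.
Σ<-layers : ∀ p h (g C : ℕ → ℕ) →
  (∀ j → suc j ℕ.≤ g h → 1 ℕ.≤ C (suc j)) →
  (∀ j → suc j ℕ.≤ g h → ∀ n → C (suc j) ℕ.≤ n ⇔ suc j ℕ.≤ g n) →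
  ∀ M → M ℕ.≤ g h →
  Σ< h (λ i → ℕℚ (M ℕ.⊓ g (h ℕ.∸ i)) ℚ.* ℕℚ (mch p i)) ≡ Σ< M (λ j → ℕℚ (mch (suc p) (h ℕ.∸ C (suc j))))
Σ<-layers p h g C C≥1 C⇔ zero _ =
  trans (Σ<-* h 0ℚ (λ i → ℕℚ (mch p i))) (ℚP.*-zeroˡ (Σ< h (λ i → ℕℚ (mch p i))))
Σ<-layers p h g C C≥1 C⇔ (suc M) M<gh = begin
  Σ< h (λ i → ℕℚ (suc M ℕ.⊓ g (h ℕ.∸ i)) ℚ.* s i)
    ≡⟨ Σ<-cong h (λ i i<h → trans (cong (ℚ._* s i) (ℕℚ-suc-⊓ M (g (h ℕ.∸ i))))
         (trans (ℚP.*-distribʳ-+ (s i) (ℕℚ (M ℕ.⊓ g (h ℕ.∸ i))) _)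
           (cong (λ x → ℕℚ (M ℕ.⊓ g (h ℕ.∸ i)) ℚ.* s i ℚ.+ x ℚ.* s i)
             (𝟙-cong (suc M ℕ.≤? g (h ℕ.∸ i)) (suc i ℕ.≤? suc (h ℕ.∸ c)) (threshold i i<h))))) ⟩
  Σ< h (λ i → ℕℚ (M ℕ.⊓ g (h ℕ.∸ i)) ℚ.* s i ℚ.+ 𝟙 (suc i ℕ.≤? suc (h ℕ.∸ c)) ℚ.* s i)
    ≡⟨ Σ<-+ h (λ i → ℕℚ (M ℕ.⊓ g (h ℕ.∸ i)) ℚ.* s i) _ ⟩
  Σ< h (λ i → ℕℚ (M ℕ.⊓ g (h ℕ.∸ i)) ℚ.* s i) ℚ.+ Σ< h (λ i → 𝟙 (suc i ℕ.≤? suc (h ℕ.∸ c)) ℚ.* s i)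
    ≡⟨ cong₂ ℚ._+_ (Σ<-layers p h g C C≥1 C⇔ M (ℕP.<⇒≤ M<gh))
         -- The new layer keeps the indices i ≤ h - c. This range stays inside i < h because c ≥ 1,
         -- and its s_i add up to one multiset coefficient.
         (trans (Σ<-𝟙 h (suc (h ℕ.∸ c)) s (ℕP.∸-monoʳ-< (C≥1 M M<gh) c≤h)) (Σ<-mch p (h ℕ.∸ c))) ⟩
  Σ< M (λ j → ℕℚ (mch (suc p) (h ℕ.∸ C (suc j)))) ℚ.+ ℕℚ (mch (suc p) (h ℕ.∸ c))
    ≡⟨ Σ<-suc M (λ j → ℕℚ (mch (suc p) (h ℕ.∸ C (suc j)))) ⟨
  Σ< (suc M) (λ j → ℕℚ (mch (suc p) (h ℕ.∸ C (suc j)))) ∎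
  where
  open ≡-Reasoning
  s : ℕ → ℚ
  s i = ℕℚ (mch p i)
  c : ℕ
  c = C (suc M)
  c≤h : c ℕ.≤ h
  c≤h = Equivalence.from (C⇔ M M<gh h) M<gh
  threshold : ∀ i → i ℕ.< h → suc M ℕ.≤ g (h ℕ.∸ i) ⇔ suc i ℕ.≤ suc (h ℕ.∸ c)
  threshold i i<h = mk⇔
    (λ le → s≤s (ℕP.m+n≤o⇒m≤o∸n i (subst (i ℕ.+ c ℕ.≤_) (ℕP.m+[n∸m]≡n (ℕP.<⇒≤ i<h)) (ℕP.+-monoʳ-≤ i (Equivalence.from (C⇔ M M<gh (h ℕ.∸ i)) le)))))
    (λ { (s≤s le) → Equivalence.to (C⇔ M M<gh (h ℕ.∸ i)) (ℕP.m+n≤o⇒m≤o∸n c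
       (subst (ℕ._≤ h) (ℕP.+-comm i c) (subst (i ℕ.+ c ℕ.≤_) (ℕP.m∸n+n≡m c≤h) (ℕP.+-monoˡ-≤ c le)))) })

module _ (x : ℚ) (0≤x : 0ℚ ℚ.≤ x) where

  private
    ⌊_x⌋ : ℕ → ℤ
    ⌊ n x⌋ = floor (ℕℚ n ℚ.* x)

    g C : ℕ → ℕ
    g n = ℤ.∣ ⌊ n x⌋ ∣
    C j = ℤ.∣ ceiling (ℕℚ j ÷' x) ∣

    0≤nx : ∀ n → 0ℚ ℚ.≤ ℕℚ n ℚ.* x
    0≤nx n = subst (ℚ._≤ ℕℚ n ℚ.* x) (ℚP.*-zeroˡ x)
      (ℚP.*-monoʳ-≤-nonNeg x {{ℚ.nonNegative 0≤x}} (toℚ-mono (+ 0) (+ n) (ℤ.+≤+ z≤n)))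

    +g : ∀ n → + g n ≡ ⌊ n x⌋
    +g n = ℤP.0≤i⇒+∣i∣≡i (≤floor (+ 0) _ (0≤nx n))

    ≤g : ∀ j n → j ℕ.≤ g n ⇔ ℕℚ j ℚ.≤ ℕℚ n ℚ.* x
    ≤g j n = mk⇔
      (λ le → ≤floor⁻ (+ j) _ (subst (+ j ℤ.≤_) (+g n) (ℤ.+≤+ le)))
      (λ le → ℤP.drop‿+≤+ (subst (+ j ℤ.≤_) (sym (+g n)) (≤floor (+ j) _ le)))

    ℕℚ-suc≰0 : ∀ j → ¬ ℕℚ (suc j) ℚ.≤ 0ℚ
    ℕℚ-suc≰0 j le with toℚ-cancel (+ suc j) (+ 0) le
    ... | ℤ.+≤+ ()

    module _ (h j : ℕ) (j<gh : suc j ℕ.≤ g h) where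
      -- For x = 0 there is no layer at all, so the existence of one rules out the junk value of
      -- `÷'`.
      x≢0 : x ≢ 0ℚ
      x≢0 x≡0 = ℕℚ-suc≰0 j (subst (ℕℚ (suc j) ℚ.≤_) (trans (cong (ℕℚ h ℚ.*_) x≡0) (ℚP.*-zeroʳ (ℕℚ h))) (Equivalence.to (≤g (suc j) h) j<gh))

      instance
        x>0 : ℚ.Positive x
        x>0 = ℚP.nonNeg∧nonZero⇒pos x {{ℚ.nonNegative 0≤x}} {{ℚ.≢-nonZero x≢0}}

      1≤ceiling : + 1 ℤ.≤ ceiling (ℕℚ (suc j) ÷' x)
      1≤ceiling = ℤP.i<j⇒suc[i]≤j (ℤP.≰⇒> λ le → ℕℚ-suc≰0 j
        (subst (ℕℚ (suc j) ℚ.≤_) (ℚP.*-zeroˡ x) (ceiling-÷'≤⁻ (ℕℚ (suc j)) x (+ 0) le)))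

      +C : + C (suc j) ≡ ceiling (ℕℚ (suc j) ÷' x)
      +C = ℤP.0≤i⇒+∣i∣≡i (ℤP.≤-trans (ℤ.+≤+ z≤n) 1≤ceiling)

      1≤C : 1 ℕ.≤ C (suc j)
      1≤C = ℤP.drop‿+≤+ (subst (+ 1 ℤ.≤_) (sym +C) 1≤ceiling)

      C≤ : ∀ n → C (suc j) ℕ.≤ n ⇔ suc j ℕ.≤ g n
      C≤ n = mk⇔
        (λ le → Equivalence.from (≤g (suc j) n) (ceiling-÷'≤⁻ (ℕℚ (suc j)) x (+ n) (subst (ℤ._≤ + n) +C (ℤ.+≤+ le))))
        (λ le → ℤP.drop‿+≤+ (subst (ℤ._≤ + n) (sym +C) (ceiling-÷'≤ (ℕℚ (suc j)) x (+ n) (Equivalence.to (≤g (suc j) n) le))))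

      -- The absolute value inside `term` is a true difference: a layer that lies below `g h` has
      -- its threshold at or below h.
      term-C : ∀ ℓ → term h ℓ x (suc j) ≡ ℕℚ (mch ℓ (h ℕ.∸ C (suc j)))
      term-C ℓ = cong (λ z → ℕℚ (mch ℓ z)) (trans (cong (λ z → ℤ.∣ + h ℤ.- z ∣) (sym +C))
        (cong ℤ.∣_∣ (trans (ℤP.m-n≡m⊖n h (C (suc j))) (ℤP.⊖-≥ (Equivalence.from (C≤ h) j<gh)))))

  T-floor : ∀ p h .{{_ : ℕ.NonZero h}} → T p h (λ n → toℚ (floor (ℕℚ n ℚ.* x)))
    ≡ ℕℚ (suc p) ℚ.* Σ1to ℤ.∣ floor (ℕℚ h ℚ.* x) ∣ (term h (suc p) x) ℚ.- toℚ (floor (ℕℚ h ℚ.* x)) ℚ.* ℕℚ (mch (suc p) h)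
  T-floor p h = cong (λ y → ℕℚ (suc p) ℚ.* y ℚ.- toℚ ⌊ h x⌋ ℚ.* ℕℚ (mch (suc p) h)) (begin
    Σ< h (λ i → toℚ ⌊ h ℕ.∸ i x⌋ ℚ.* ℕℚ (mch p i))
      -- The cap `g h` changes nothing since `g` is monotone; it only brings the sum into the shape
      -- of `Σ<-layers`.
      ≡⟨ Σ<-cong h (λ i _ → cong (ℚ._* ℕℚ (mch p i)) (trans (cong toℚ (sym (+g (h ℕ.∸ i)))) (cong ℕℚ (sym (ℕP.m≥n⇒m⊓n≡n (g-mono i)))))) ⟩
    Σ< h (λ i → ℕℚ (g h ℕ.⊓ g (h ℕ.∸ i)) ℚ.* ℕℚ (mch p i))
      ≡⟨ Σ<-layers p h g C (1≤C h) (C≤ h) (g h) ℕP.≤-refl ⟩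
    Σ< (g h) (λ j → ℕℚ (mch (suc p) (h ℕ.∸ C (suc j))))
      ≡⟨ Σ<-cong (g h) (λ j j<gh → sym (term-C h j j<gh (suc p))) ⟩
    Σ1to (g h) (term h (suc p) x) ∎)
    where
    open ≡-Reasoning
    g-mono : ∀ i → g (h ℕ.∸ i) ℕ.≤ g h
    g-mono i = Equivalence.from (≤g (g (h ℕ.∸ i)) h) (ℚP.≤-trans (Equivalence.to (≤g _ (h ℕ.∸ i)) ℕP.≤-refl)
      (ℚP.*-monoʳ-≤-nonNeg x {{ℚ.nonNegative 0≤x}} (toℚ-mono (+ (h ℕ.∸ i)) (+ h) (ℤ.+≤+ (ℕP.m∸n≤m h i)))))

-- The fractional part of n α is n x - ⌊n x⌋ with x = {α}; T kills the linear part and `T-floor`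
-- evaluates the rest. The cases α = a'/b' and α = -a/b yield the third and the fourth expression.
T-frac : ∀ p h .{{_ : ℕ.NonZero h}} α → let x = frac α ; N = floor (ℕℚ h ℚ.* x) in
  T p h (λ n → frac (ℕℚ n ℚ.* α)) ≡ toℚ N ℚ.* ℕℚ (mch (suc p) h) ℚ.- ℕℚ (suc p) ℚ.* Σ1to ℤ.∣ N ∣ (term h (suc p) x)
T-frac p h α = begin
  T p h (λ n → frac (ℕℚ n ℚ.* α))
    ≡⟨ T-cong p h (λ n _ _ → trans (frac-*-frac n α) (lem (ℕℚ n) x (toℚ (floor (ℕℚ n ℚ.* x))))) ⟩
  T p h (λ n → x ℚ.* ℕℚ n ℚ.+ (ℚ.- 1ℚ) ℚ.* toℚ (floor (ℕℚ n ℚ.* x)))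
    ≡⟨ trans (T-+ p h (λ n → x ℚ.* ℕℚ n) (λ n → (ℚ.- 1ℚ) ℚ.* toℚ (floor (ℕℚ n ℚ.* x)))) (cong₂ ℚ._+_ (T-* p h x ℕℚ) (T-* p h (ℚ.- 1ℚ) (λ n → toℚ (floor (ℕℚ n ℚ.* x))))) ⟩
  x ℚ.* T p h ℕℚ ℚ.+ (ℚ.- 1ℚ) ℚ.* T p h (λ n → toℚ (floor (ℕℚ n ℚ.* x)))
    ≡⟨ cong₂ (λ y z → x ℚ.* y ℚ.+ (ℚ.- 1ℚ) ℚ.* z) (T-id p h) (T-floor x (0≤frac α) p h) ⟩
  x ℚ.* 0ℚ ℚ.+ (ℚ.- 1ℚ) ℚ.* (ℕℚ (suc p) ℚ.* Θ ℚ.- toℚ N ℚ.* S)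
    ≡⟨ lem′ x (ℕℚ (suc p) ℚ.* Θ) (toℚ N ℚ.* S) ⟩
  toℚ N ℚ.* S ℚ.- ℕℚ (suc p) ℚ.* Θ ∎
  where
  open ≡-Reasoning
  x Θ S : ℚ
  N : ℤ
  x = frac α
  N = floor (ℕℚ h ℚ.* x)
  Θ = Σ1to ℤ.∣ N ∣ (term h (suc p) x)
  S = ℕℚ (mch (suc p) h)
  lem : ∀ n x w → n ℚ.* x ℚ.- w ≡ x ℚ.* n ℚ.+ (ℚ.- 1ℚ) ℚ.* w
  lem = solve-∀ ℚ-ring
  lem′ : ∀ x u v → x ℚ.* 0ℚ ℚ.+ (ℚ.- 1ℚ) ℚ.* (u ℚ.- v) ≡ v ℚ.- u
  lem′ = solve-∀ ℚ-ring

-- Farey neighbours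

gcd-↥-↧ : ∀ p → gcd ℤ.∣ ↥ p ∣ (↧ₙ p) ≡ 1
gcd-↥-↧ (ℚ.mkℚ _ _ c) = Coprimality.coprime⇒gcd≡1 (Coprimality.recompute c)

-- IsPred only speaks of reduced fractions, so z / n is put in lowest terms first.
successor-least : ∀ h a b a' b' → IsPred h a b a' b' → ∀ z n → 1 ℕ.≤ n → n ℕ.≤ h →
  a' ℤ.* + n ℤ.< z ℤ.* + b' → a ℤ.* + n ℤ.≤ z ℤ.* + b
successor-least h a b a' b' (_ , _ , greatest) z n@(suc _) _ n≤h lt = ℤP.≮⇒≥ λ zb<an →
  ℤP.<⇒≱ lt (subst₂ ℤ._≤_
    (trans (swap x (+ b') (+ g)) (cong (ℤ._* + b') xg≡z))
    (trans (ℤP.*-assoc a' (↧ p) (+ g)) (cong (a' ℤ.*_) yg≡n))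
    (ℤP.*-monoʳ-≤-nonNeg (+ g) (greatest x y farey (ℤP.*-cancelʳ-<-nonNeg (+ g)
      (subst₂ ℤ._<_
        (sym (trans (swap x (+ b) (+ g)) (cong (ℤ._* + b) xg≡z)))
        (sym (trans (ℤP.*-assoc a (↧ p) (+ g)) (cong (a ℤ.*_) yg≡n)))
        zb<an)))))
  where
  p : ℚ
  p = z ℚ./ n
  x : ℤ
  x = ↥ p
  y g : ℕ
  y = ↧ₙ p
  g = ℤ.∣ ℤG.gcd z (+ n) ∣
  xg≡z : x ℤ.* + g ≡ z
  xg≡z = ℚP.↥-/ z n
  yg≡n : + y ℤ.* + g ≡ + n
  yg≡n = ℚP.↧-/ z n
  yg≡n′ : y ℕ.* g ≡ n
  yg≡n′ = ℤP.+-injective (trans (ℤP.pos-* y g) yg≡n)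
  swap : ∀ x b g → x ℤ.* b ℤ.* g ≡ x ℤ.* g ℤ.* b
  swap = ℤ-solve
  g≢0 : ℕ.NonZero g
  g≢0 = ℕP.m*n≢0⇒n≢0 y {{subst ℕ.NonZero (sym yg≡n′) _}}
  farey : IsFarey h x y
  farey = s≤s z≤n , ℕP.≤-trans (ℕP.m≤m*n y g {{g≢0}}) (ℕP.≤-trans (ℕP.≤-reflexive yg≡n′) n≤h) , gcd-↥-↧ p

floor-neg-// : ∀ z x d → x ℤ.≤ ℤ.suc z ℤ.* + suc d → z ℤ.* + suc d ℤ.< x →
  floor ((ℤ.- x) // suc d) ≡ ℤ.- ℤ.suc z
floor-neg-// z x d le lt = ℤP.≤-antisym
  (ℤP.≮⇒≥ λ lt′ → ℤP.<⇒≱ lt (ℤP.neg-cancel-≤ (subst (ℤ._≤ ℤ.- x) (lem′ z (+ suc d)) (≤floor-//⁻ (ℤ.- z) (ℤ.- x) d (subst (ℤ._≤ floor ((ℤ.- x) // suc d)) (lem″ z) (ℤP.i<j⇒suc[i]≤j lt′))))))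
  (≤floor-// (ℤ.- ℤ.suc z) (ℤ.- x) d (subst (ℤ._≤ ℤ.- x) (lem (ℤ.suc z) (+ suc d)) (ℤP.neg-mono-≤ le)))
  where
  lem : ∀ z d → ℤ.- (z ℤ.* d) ≡ ℤ.- z ℤ.* d
  lem = ℤ-solve
  lem′ : ∀ z d → ℤ.- z ℤ.* d ≡ ℤ.- (z ℤ.* d)
  lem′ = ℤ-solve
  lem″ : ∀ z → + 1 ℤ.+ ℤ.- (+ 1 ℤ.+ z) ≡ ℤ.- z
  lem″ = ℤ-solve

module _ (h : ℕ) (a a' : ℤ) (b-1 b'-1 : ℕ) (pred : IsPred h a (suc b-1) a' (suc b'-1)) where

  private
    b b' : ℕ
    b = suc b-1
    b' = suc b'-1
    α α' : ℚ
    α = a // b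
    α' = a' // b'

    F : ℕ → ℤ
    F n = floor ((+ n ℤ.* a') // b')

  -- The fraction `ℤ.suc (F n)` / n lies strictly above a'/b' and its denominator is at most h, so
  -- it cannot lie below a/b.
  suc-floor-bound : ∀ n → 1 ℕ.≤ n → n ℕ.≤ h → a ℤ.* + n ℤ.≤ ℤ.suc (F n) ℤ.* + b
  suc-floor-bound n 1≤n n≤h = successor-least h a b a' b' pred (ℤ.suc (F n)) n 1≤n n≤h (ℤP.≰⇒> λ le →
    ℤP.<-irrefl refl (ℤP.suc[i]≤j⇒i<j (≤floor-// (ℤ.suc (F n)) (+ n ℤ.* a') b'-1 (subst (ℤ.suc (F n) ℤ.* + b' ℤ.≤_) (ℤP.*-comm a' (+ n)) le))))

  -- The number n a/b lies in the half-open interval (F n, F n + 1]: strictly above n a'/b' ≥ F n,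
  -- and bounded by `suc-floor-bound`. The signs are those in the definition of φ.
  floor-neg-successor : ∀ n → 1 ℕ.≤ n → n ℕ.≤ h → floor ((ℤ.- (+ n ℤ.* a)) // b) ≡ ℤ.- ℤ.suc (F n)
  floor-neg-successor n@(suc _) 1≤n n≤h = floor-neg-// (F n) (+ n ℤ.* a) b-1
    (subst (ℤ._≤ ℤ.suc (F n) ℤ.* + b) (ℤP.*-comm a (+ n)) (suc-floor-bound n 1≤n n≤h))
    (ℤP.*-cancelʳ-<-nonNeg (+ b') (ℤP.≤-<-trans
      (subst₂ ℤ._≤_ (swap (F n) (+ b') (+ b)) (ℤP.*-assoc (+ n) a' (+ b)) (ℤP.*-monoʳ-≤-nonNeg (+ b) (≤floor-//⁻ (F n) (+ n ℤ.* a') b'-1 ℤP.≤-refl)))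
      (subst (+ n ℤ.* (a' ℤ.* + b) ℤ.<_) (sym (ℤP.*-assoc (+ n) a (+ b'))) (ℤP.*-monoˡ-<-pos (+ n) (proj₁ (proj₂ pred))))))
    where
    swap : ∀ x y z → x ℤ.* y ℤ.* z ≡ x ℤ.* z ℤ.* y
    swap = ℤ-solve

  -- The two floors cancel up to 1, so the sum is affine in n, and T is known on affine functions.
  -- This is the bridge between a'/b' and a/b.
  φ+φ' : ∀ n → 1 ℕ.≤ n → n ℕ.≤ h → φ a b n ℚ.+ φ' a' b' n ≡ 1ℚ ℚ.+ (α' ℚ.- α) ℚ.* ℕℚ n
  φ+φ' n 1≤n n≤h = begin
    ((ℤ.- (+ n ℤ.* a)) // b ℚ.- toℚ (floor ((ℤ.- (+ n ℤ.* a)) // b))) ℚ.+ ((+ n ℤ.* a') // b' ℚ.- toℚ (F n))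
      ≡⟨ cong₂ (λ x y → (x ℚ.- y) ℚ.+ ((+ n ℤ.* a') // b' ℚ.- toℚ (F n)))
           (trans (neg-// (+ n ℤ.* a) b-1) (cong ℚ.-_ (toℚ-*-// (+ n) a b-1)))
           (trans (cong toℚ (floor-neg-successor n 1≤n n≤h)) (trans (toℚ-neg (ℤ.suc (F n))) (cong ℚ.-_ (toℚ-+ (+ 1) (F n))))) ⟩
    (ℚ.- (ℕℚ n ℚ.* α) ℚ.- (ℚ.- (1ℚ ℚ.+ toℚ (F n)))) ℚ.+ ((+ n ℤ.* a') // b' ℚ.- toℚ (F n))
      ≡⟨ cong (λ x → (ℚ.- (ℕℚ n ℚ.* α) ℚ.- (ℚ.- (1ℚ ℚ.+ toℚ (F n)))) ℚ.+ (x ℚ.- toℚ (F n))) (toℚ-*-// (+ n) a' b'-1) ⟩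
    (ℚ.- (ℕℚ n ℚ.* α) ℚ.- (ℚ.- (1ℚ ℚ.+ toℚ (F n)))) ℚ.+ (ℕℚ n ℚ.* α' ℚ.- toℚ (F n))
      ≡⟨ lem (ℕℚ n) α α' (toℚ (F n)) ⟩
    1ℚ ℚ.+ (α' ℚ.- α) ℚ.* ℕℚ n ∎
    where
    open ≡-Reasoning
    lem : ∀ n α α' f → (ℚ.- (n ℚ.* α) ℚ.- (ℚ.- (1ℚ ℚ.+ f))) ℚ.+ (n ℚ.* α' ℚ.- f) ≡ 1ℚ ℚ.+ (α' ℚ.- α) ℚ.* n
    lem = solve-∀ ℚ-ring

  -- The four expressions for E₀

  module _ (p : ℕ) .{{_ : ℕ.NonZero h}} where

    private
      ℓ : ℕ
      ℓ = suc p
      H s S : ℚ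
      H = ℕℚ (h ℕ.∸ 1)
      s = ℕℚ (mch p h)
      S = ℕℚ (mch ℓ h)

    E0-1-T : E0-1 h a' b' ℓ ≡ ℚ.- T p h (φ' a' b')
    E0-1-T = lem (ℕℚ ℓ ℚ.* Σ< h (λ i → φ' a' b' (h ℕ.∸ i) ℚ.* ℕℚ (mch p i))) (φ' a' b' h ℚ.* S)
      where
      lem : ∀ x y → ℚ.- x ℚ.+ y ≡ ℚ.- (x ℚ.- y)
      lem = solve-∀ ℚ-ring

    E0-2-T : E0-2 h a b ℓ ≡ ℚ.- (H ℚ.* s) ℚ.+ T p h (φ a b)
    E0-2-T = ℚP.+-assoc (ℚ.- (H ℚ.* s)) (ℕℚ ℓ ℚ.* Σ< h (λ i → φ a b (h ℕ.∸ i) ℚ.* ℕℚ (mch p i))) (ℚ.- (φ a b h ℚ.* S))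

    E0-1-floor : E0-1 h a' b' ℓ ≡ T p h (λ n → toℚ (F n))
    E0-1-floor = begin
      E0-1 h a' b' ℓ                                   ≡⟨ E0-1-T ⟩
      ℚ.- T p h (φ' a' b')                             ≡⟨ cong ℚ.-_ (T-cong p h (λ n _ _ → trans (cong (ℚ._- toℚ (F n)) (toℚ-*-// (+ n) a' b'-1)) (lem (ℕℚ n) α' (toℚ (F n))))) ⟩
      ℚ.- T p h (λ n → α' ℚ.* ℕℚ n ℚ.+ (ℚ.- 1ℚ) ℚ.* toℚ (F n))
        ≡⟨ cong ℚ.-_ (trans (T-+ p h (λ n → α' ℚ.* ℕℚ n) (λ n → (ℚ.- 1ℚ) ℚ.* toℚ (F n)))
             (cong₂ ℚ._+_ (trans (T-* p h α' ℕℚ) (cong (α' ℚ.*_) (T-id p h))) (T-* p h (ℚ.- 1ℚ) (λ n → toℚ (F n))))) ⟩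
      ℚ.- (α' ℚ.* 0ℚ ℚ.+ (ℚ.- 1ℚ) ℚ.* T p h (λ n → toℚ (F n)))   ≡⟨ lem′ α' (T p h (λ n → toℚ (F n))) ⟩
      T p h (λ n → toℚ (F n))                          ∎
      where
      open ≡-Reasoning
      lem : ∀ n x f → n ℚ.* x ℚ.- f ≡ x ℚ.* n ℚ.+ (ℚ.- 1ℚ) ℚ.* f
      lem = solve-∀ ℚ-ring
      lem′ : ∀ x t → ℚ.- (x ℚ.* 0ℚ ℚ.+ (ℚ.- 1ℚ) ℚ.* t) ≡ t
      lem′ = solve-∀ ℚ-ring

    E0-1≡E0-2 : E0-1 h a' b' ℓ ≡ E0-2 h a b ℓ
    E0-1≡E0-2 = begin
      E0-1 h a' b' ℓ                                    ≡⟨ E0-1-T ⟩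
      ℚ.- T'                                            ≡⟨ lem (H ℚ.* s) (T p h (φ a b)) T' ⟩
      (ℚ.- (H ℚ.* s) ℚ.+ T p h (φ a b)) ℚ.+ (H ℚ.* s ℚ.- (T p h (φ a b) ℚ.+ T'))
        ≡⟨ cong (λ x → (ℚ.- (H ℚ.* s) ℚ.+ T p h (φ a b)) ℚ.+ (H ℚ.* s ℚ.- x)) total ⟩
      (ℚ.- (H ℚ.* s) ℚ.+ T p h (φ a b)) ℚ.+ (H ℚ.* s ℚ.- H ℚ.* s)
        ≡⟨ lem′ (ℚ.- (H ℚ.* s) ℚ.+ T p h (φ a b)) (H ℚ.* s) ⟩
      ℚ.- (H ℚ.* s) ℚ.+ T p h (φ a b)                   ≡⟨ E0-2-T ⟨
      E0-2 h a b ℓ                                      ∎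
      where
      open ≡-Reasoning
      T' : ℚ
      T' = T p h (φ' a' b')
      lem : ∀ x y z → ℚ.- z ≡ (ℚ.- x ℚ.+ y) ℚ.+ (x ℚ.- (y ℚ.+ z))
      lem = solve-∀ ℚ-ring
      lem′ : ∀ x y → x ℚ.+ (y ℚ.- y) ≡ x
      lem′ = solve-∀ ℚ-ring
      lem″ : ∀ x y → x ℚ.+ y ℚ.* 0ℚ ≡ x
      lem″ = solve-∀ ℚ-ring
      total : T p h (φ a b) ℚ.+ T' ≡ H ℚ.* s
      total = begin
        T p h (φ a b) ℚ.+ T'                              ≡⟨ T-+ p h (φ a b) (φ' a' b') ⟨
        T p h (λ n → φ a b n ℚ.+ φ' a' b' n)              ≡⟨ T-cong p h φ+φ' ⟩
        T p h (λ n → 1ℚ ℚ.+ (α' ℚ.- α) ℚ.* ℕℚ n)          ≡⟨ T-+ p h (const 1ℚ) (λ n → (α' ℚ.- α) ℚ.* ℕℚ n) ⟩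
        T p h (const 1ℚ) ℚ.+ T p h (λ n → (α' ℚ.- α) ℚ.* ℕℚ n)
          ≡⟨ cong₂ ℚ._+_ (T-1 p h) (trans (T-* p h (α' ℚ.- α) ℕℚ) (cong ((α' ℚ.- α) ℚ.*_) (T-id p h))) ⟩
        H ℚ.* s ℚ.+ (α' ℚ.- α) ℚ.* 0ℚ                     ≡⟨ lem″ (H ℚ.* s) (α' ℚ.- α) ⟩
        H ℚ.* s                                           ∎

    E0-1≡E0-3 : E0-1 h a' b' ℓ ≡ E0-3 h a' b' ℓ
    E0-1≡E0-3 = begin
      E0-1 h a' b' ℓ                                         ≡⟨ E0-1-T ⟩
      ℚ.- T p h (φ' a' b')                                   ≡⟨ cong ℚ.-_ (T-cong p h (λ n _ _ → cong frac (toℚ-*-// (+ n) a' b'-1))) ⟩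
      ℚ.- T p h (λ n → frac (ℕℚ n ℚ.* α'))                   ≡⟨ cong ℚ.-_ (T-frac p h α') ⟩
      ℚ.- (N (frac α') ℚ.- Θ (frac α'))                                      ≡⟨ cong (λ y → ℚ.- (N (frac y) ℚ.- Θ (frac y))) (cong (_// b') (ℤP.*-identityˡ a')) ⟨
      ℚ.- (N (φ' a' b' 1) ℚ.- Θ (φ' a' b' 1))                                   ≡⟨ lem (N (φ' a' b' 1)) (Θ (φ' a' b' 1)) ⟩
      E0-3 h a' b' ℓ                                         ∎
      where
      open ≡-Reasoning
      N Θ : ℚ → ℚ
      N x = toℚ (floor (ℕℚ h ℚ.* x)) ℚ.* S
      Θ x = ℕℚ ℓ ℚ.* Σ1to ℤ.∣ floor (ℕℚ h ℚ.* x) ∣ (term h ℓ x)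
      lem : ∀ x y → ℚ.- (x ℚ.- y) ≡ ℚ.- x ℚ.+ y
      lem = solve-∀ ℚ-ring

    E0-2≡E0-4 : E0-2 h a b ℓ ≡ E0-4 h a b ℓ
    E0-2≡E0-4 = begin
      E0-2 h a b ℓ                                          ≡⟨ E0-2-T ⟩
      K ℚ.+ T p h (φ a b)                                   ≡⟨ cong (K ℚ.+_) (T-cong p h (λ n _ _ → cong frac (multiple n))) ⟩
      K ℚ.+ T p h (λ n → frac (ℕℚ n ℚ.* (ℚ.- α)))           ≡⟨ cong (K ℚ.+_) (T-frac p h (ℚ.- α)) ⟩
      K ℚ.+ (N (frac (ℚ.- α)) ℚ.- Θ (frac (ℚ.- α)))         ≡⟨ cong (λ y → K ℚ.+ (N (frac y) ℚ.- Θ (frac y))) (trans (cong (λ z → (ℤ.- z) // b) (ℤP.*-identityˡ a)) (neg-// a b-1)) ⟨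
      K ℚ.+ (N (φ a b 1) ℚ.- Θ (φ a b 1))                   ≡⟨ ℚP.+-assoc K (N (φ a b 1)) (ℚ.- Θ (φ a b 1)) ⟨
      E0-4 h a b ℓ                                          ∎
      where
      open ≡-Reasoning
      K : ℚ
      K = ℚ.- (H ℚ.* s)
      N Θ : ℚ → ℚ
      N x = toℚ (floor (ℕℚ h ℚ.* x)) ℚ.* S
      Θ x = ℕℚ ℓ ℚ.* Σ1to ℤ.∣ floor (ℕℚ h ℚ.* x) ∣ (term h ℓ x)
      lem : ∀ n α → ℚ.- (n ℚ.* α) ≡ n ℚ.* (ℚ.- α)
      lem = solve-∀ ℚ-ring
      multiple : ∀ n → (ℤ.- (+ n ℤ.* a)) // b ≡ ℕℚ n ℚ.* (ℚ.- α)
      multiple n = trans (neg-// (+ n ℤ.* a) b-1) (trans (cong ℚ.-_ (toℚ-*-// (+ n) a b-1)) (lem (ℕℚ n) α))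

-- Enumerating sumsets

private variable
  A B : Set

-- Two duplicate-free lists with the same members are permutations of each other. The given numbers
-- k, ℓ, r and ω are thereby evaluated on explicit lists.
IsCard-length : {P : A → Set} {n : ℕ} → IsCard P n → ∀ {xs} → Unique xs → (∀ x → x ∈ xs ⇔ P x) → length xs ≡ n
IsCard-length card {xs} xs! xs⇔P = trans
  (↭-length (∼bag⇒↭ (unique∧set⇒bag xs! (IsCard.unique card) λ {x} → ⇔.trans (xs⇔P x) (⇔.sym (IsCard.complete card x)))))
  (IsCard.size card)

concatMap-! : {f : A → List B} {xs : List A} → Unique xs → (∀ {x} → x ∈ xs → Unique (f x)) →
  (∀ {x y z} → x ∈ xs → y ∈ xs → z ∈ f x → z ∈ f y → x ≡ y) → Unique (concatMap f xs)
concatMap-! [] f! sep = []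
concatMap-! {f = f} {x ∷ xs} (x∉xs ∷ xs!) f! sep = Unique.++⁺ (f! (here refl))
  (concatMap-! xs! (f! ∘ there) (λ p q → sep (there p) (there q)))
  λ { (z∈fx , z∈rest) → disjoint z∈fx (∈-concatMap⁻ f {xs} z∈rest) }
  where
  disjoint : ∀ {z} → z ∈ f x → ¬ Any ((z ∈_) ∘ f) xs
  disjoint z∈fx z∈ with find z∈
  ... | y , y∈xs , z∈fy = All.lookup x∉xs y∈xs (sep (here refl) (there y∈xs) z∈fx z∈fy)

length-concatMap : (f : A → List B) (xs : List A) → length (concatMap f xs) ≡ sum (map (length ∘ f) xs)
length-concatMap f [] = refl
length-concatMap f (x ∷ xs) = trans (length-++ (f x)) (cong (length (f x) ℕ.+_) (length-concatMap f xs))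

sum-map-concatMap : (g : B → ℕ) (f : A → List B) (xs : List A) → sum (map g (concatMap f xs)) ≡ sum (map (λ x → sum (map g (f x))) xs)
sum-map-concatMap g f [] = refl
sum-map-concatMap g f (x ∷ xs) = trans (cong sum (map-++ g (f x) _)) (trans (sum-++ (map g (f x)) _) (cong (sum (map g (f x)) ℕ.+_) (sum-map-concatMap g f xs)))

sum-map-const : (g : A → ℕ) (n : ℕ) (xs : List A) → (∀ {x} → x ∈ xs → g x ≡ n) → sum (map g xs) ≡ n ℕ.* length xs
sum-map-const g n [] eq = sym (ℕP.*-zeroʳ n)
sum-map-const g n (x ∷ xs) eq = trans (cong₂ ℕ._+_ (eq (here refl)) (sum-map-const g n xs (eq ∘ there))) (sym (ℕP.*-suc n (length xs)))

sum-map-filter : {P : A → Set} (P? : ∀ x → Dec (P x)) (f g : A → ℕ) (xs : List A) →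
  (∀ {x} → x ∈ xs → P x → f x ≡ suc (g x)) → (∀ {x} → x ∈ xs → ¬ P x → f x ≡ g x) →
  sum (map f xs) ≡ sum (map g xs) ℕ.+ length (filter P? xs)
sum-map-filter P? f g [] yes-eq no-eq = refl
sum-map-filter P? f g (x ∷ xs) yes-eq no-eq with P? x | sum-map-filter P? f g xs (yes-eq ∘ there) (no-eq ∘ there)
... | yes px | ih = trans (cong₂ ℕ._+_ (yes-eq (here refl) px) ih) (trans (cong suc (sym (ℕP.+-assoc (g x) (sum (map g xs)) (length (filter P? xs))))) (sym (ℕP.+-suc (g x ℕ.+ sum (map g xs)) (length (filter P? xs)))))
... | no ¬px | ih = trans (cong₂ ℕ._+_ (no-eq (here refl) ¬px) ih) (sym (ℕP.+-assoc (g x) (sum (map g xs)) (length (filter P? xs))))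

length-deduplicate-≤ : (_≟_ : DecidableEquality A) (xs : List A) → length (deduplicate _≟_ xs) ℕ.≤ length xs
length-deduplicate-≤ _≟_ [] = z≤n
length-deduplicate-≤ _≟_ (x ∷ xs) = s≤s (ℕP.≤-trans (length-filter (¬? ∘ (x ≟_)) (deduplicate _≟_ xs)) (length-deduplicate-≤ _≟_ xs))

length-deduplicate⇒! : (_≟_ : DecidableEquality A) (xs : List A) → length (deduplicate _≟_ xs) ≡ length xs → Unique xs
length-deduplicate⇒! _≟_ [] _ = []
length-deduplicate⇒! _≟_ (x ∷ xs) eq = AllP.¬Any⇒All¬ xs x∉xs ∷ length-deduplicate⇒! _≟_ xs (ℕP.≤-antisym (length-deduplicate-≤ _≟_ xs) xs≤)
  where
  r = deduplicate _≟_ xs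
  xs≤′ : length xs ℕ.≤ length (filter (¬? ∘ (x ≟_)) r)
  xs≤′ = ℕP.≤-reflexive (sym (ℕP.suc-injective eq))
  xs≤ : length xs ℕ.≤ length r
  xs≤ = ℕP.≤-trans xs≤′ (length-filter (¬? ∘ (x ≟_)) r)
  x∉xs : x ∉ xs
  x∉xs x∈xs = ℕP.<⇒≱ (filter-notAll (¬? ∘ (x ≟_)) r (Any.map (λ x≡y ¬x≡y → ¬x≡y x≡y) (∈-deduplicate⁺ _≟_ x∈xs)))
    (ℕP.≤-trans (length-deduplicate-≤ _≟_ xs) xs≤′)

-- One entry per multiset of size i, so that a repetition is a failure of the B_h property.
multisums : ℕ → List ℤ → List ℤ
multisums zero    xs       = [ + 0 ]
multisums (suc i) []       = []
multisums (suc i) (x ∷ xs) = map (ℤ._+_ x) (multisums i (x ∷ xs)) ++ multisums (suc i) xs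

length-multisums : ∀ i xs → length (multisums i xs) ≡ mch (length xs) i
length-multisums zero xs = refl
length-multisums (suc i) [] = sym (mch-zeroˡ i)
length-multisums (suc i) (x ∷ xs) = begin
  length (map (ℤ._+_ x) (multisums i (x ∷ xs)) ++ multisums (suc i) xs)
    ≡⟨ length-++ (map (ℤ._+_ x) (multisums i (x ∷ xs))) ⟩
  length (map (ℤ._+_ x) (multisums i (x ∷ xs))) ℕ.+ length (multisums (suc i) xs)
    ≡⟨ cong₂ ℕ._+_ (trans (length-map (ℤ._+_ x) (multisums i (x ∷ xs))) (length-multisums i (x ∷ xs))) (length-multisums (suc i) xs) ⟩
  mch (suc (length xs)) i ℕ.+ mch (length xs) (suc i)
    ≡⟨ mch-suc-suc (length xs) i ⟨
  mch (suc (length xs)) (suc i) ∎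
  where open ≡-Reasoning

∈-multisums⁻ : ∀ i xs {z} → z ∈ multisums i xs → Sumset i (_∈ xs) z
∈-multisums⁻ zero xs (here refl) = [] , refl , [] , refl
∈-multisums⁻ (suc i) (x ∷ xs) = step (∈-multisums⁻ i (x ∷ xs)) (∈-multisums⁻ (suc i) xs)
  where
  step : (∀ {w} → w ∈ multisums i (x ∷ xs) → Sumset i (_∈ x ∷ xs) w) →
         (∀ {w} → w ∈ multisums (suc i) xs → Sumset (suc i) (_∈ xs) w) →
         ∀ {z} → z ∈ multisums (suc i) (x ∷ xs) → Sumset (suc i) (_∈ x ∷ xs) z
  step ihˡ ihʳ z∈ with ∈-++⁻ (map (ℤ._+_ x) (multisums i (x ∷ xs))) z∈
  ... | inj₂ z∈ʳ = let ys , len , all , eq = ihʳ z∈ʳ in ys , len , All.map there all , eq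
  ... | inj₁ z∈ˡ with ∈-map⁻ (ℤ._+_ x) z∈ˡ
  ...   | w , w∈ , refl = let ys , len , all , eq = ihˡ w∈ in x ∷ ys , cong suc len , here refl ∷ all , cong (ℤ._+_ x) eq

-- Either x does not occur in the multiset, or one occurrence can be moved to the front: exactly the
-- two branches of `multisums`.
extract : ∀ x {xs} ys → All (_∈ x ∷ xs) ys →
  All (_∈ xs) ys ⊎ ∃ λ zs → suc (length zs) ≡ length ys × All (_∈ x ∷ xs) zs × x ℤ.+ sumℤ zs ≡ sumℤ ys
extract x [] [] = inj₁ []
extract x (y ∷ ys) (here refl ∷ ys∈) = inj₂ (ys , refl , ys∈ , refl)
extract x (y ∷ ys) (there y∈ ∷ ys∈) with extract x ys ys∈
... | inj₁ all = inj₁ (y∈ ∷ all)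
... | inj₂ (zs , len , all , eq) = inj₂ (y ∷ zs , cong suc len , there y∈ ∷ all , trans (swap x y (sumℤ zs)) (cong (ℤ._+_ y) eq))
  where
  swap : ∀ x y z → x ℤ.+ (y ℤ.+ z) ≡ y ℤ.+ (x ℤ.+ z)
  swap = ℤ-solve

∈-multisums⁺ : ∀ i xs {z} → Sumset i (_∈ xs) z → z ∈ multisums i xs
∈-multisums⁺ zero xs ([] , refl , _ , refl) = here refl
∈-multisums⁺ (suc i) [] (y ∷ ys , _ , () ∷ _ , _)
∈-multisums⁺ (suc i) (x ∷ xs) = step (∈-multisums⁺ i (x ∷ xs)) (∈-multisums⁺ (suc i) xs)
  where
  step : (∀ {w} → Sumset i (_∈ x ∷ xs) w → w ∈ multisums i (x ∷ xs)) →
         (∀ {w} → Sumset (suc i) (_∈ xs) w → w ∈ multisums (suc i) xs) →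
         ∀ {z} → Sumset (suc i) (_∈ x ∷ xs) z → z ∈ multisums (suc i) (x ∷ xs)
  step ihˡ ihʳ (ys , len , all , eq) with extract x ys all
  ... | inj₁ all′ = ∈-++⁺ʳ _ (ihʳ (ys , len , all′ , eq))
  ... | inj₂ (zs , len′ , all′ , eq′) = subst (_∈ multisums (suc i) (x ∷ xs)) (trans eq′ eq)
    (∈-++⁺ˡ (∈-map⁺ (ℤ._+_ x) (ihˡ (zs , ℕP.suc-injective (trans len′ len) , all′ , refl))))

++-!ˡ : ∀ (xs : List A) {ys} → Unique (xs ++ ys) → Unique xs
++-!ˡ [] _ = []
++-!ˡ (x ∷ xs) (x∉ ∷ !) = AllP.++⁻ˡ xs x∉ ∷ ++-!ˡ xs !

-- Translation by x embeds the sums of size i into those of size i + 1, so a collision at i persists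
-- at i + 1. An element x is required, which is why Γ is later listed as a cons.
multisums-!-suc : ∀ i x xs → Unique (multisums (suc i) (x ∷ xs)) → Unique (multisums i (x ∷ xs))
multisums-!-suc i x xs ! = Unique.map⁻ (++-!ˡ (map (ℤ._+_ x) (multisums i (x ∷ xs))) !)

multisums-!-≤ : ∀ {i h} x xs → i ℕ.≤′ h → Unique (multisums h (x ∷ xs)) → Unique (multisums i (x ∷ xs))
multisums-!-≤ x xs (ℕ.≤′-reflexive refl) ! = !
multisums-!-≤ x xs (ℕ.≤′-step i≤h) ! = multisums-!-≤ x xs i≤h (multisums-!-suc _ x xs !)

Sumset-⇔ : {P Q : ℤ → Set} → (∀ x → P x ⇔ Q x) → ∀ i {z} → Sumset i P z ⇔ Sumset i Q z
Sumset-⇔ eq i = mk⇔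
  (λ (xs , len , all , eq′) → xs , len , All.map (λ {x} → Equivalence.to (eq x)) all , eq′)
  (λ (xs , len , all , eq′) → xs , len , All.map (λ {x} → Equivalence.from (eq x)) all , eq′)

∈-multisums⇔ : {Γ : ℤ → Set} (G : List ℤ) → (∀ x → x ∈ G ⇔ Γ x) → ∀ i z → z ∈ multisums i G ⇔ Sumset i Γ z
∈-multisums⇔ G G⇔Γ i z = ⇔.trans (mk⇔ (∈-multisums⁻ i G) (∈-multisums⁺ i G)) (Sumset-⇔ G⇔Γ i)

-- The deduplicated list enumerates hΓ, so the B_h property equates its length with that of the full
-- list. Hence deduplication dropped nothing.
IsBh⇒! : {Γ : ℤ → Set} (G : List ℤ) → Unique G → (∀ x → x ∈ G ⇔ Γ x) → ∀ h → IsBh h Γ → Unique (multisums h G)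
IsBh⇒! G G! G⇔Γ h bh = length-deduplicate⇒! ℤP._≟_ (multisums h G) (trans
  (bh (length G) _
    (record { elems = G ; unique = G! ; complete = G⇔Γ ; size = refl })
    (record { elems = deduplicate ℤP._≟_ (multisums h G) ; unique = deduplicate-! (multisums h G)
            ; complete = λ z → ⇔.trans (⇔.sym (deduplicate-∈⇔ ℤP._≟_)) (∈-multisums⇔ G G⇔Γ h z) ; size = refl }))
  (sym (length-multisums h G)))

-- Representations of the elements of S

0≤+ : ∀ {x y} → + 0 ℤ.≤ x → + 0 ℤ.≤ y → + 0 ℤ.≤ x ℤ.+ y
0≤+ = ℤP.+-mono-≤

0≤* : ∀ {x y} → + 0 ℤ.≤ x → + 0 ℤ.≤ y → + 0 ℤ.≤ x ℤ.* y
0≤* {+ m} {y} p q = subst (ℤ._≤ + m ℤ.* y) (ℤP.*-zeroʳ (+ m)) (ℤP.*-monoˡ-≤-nonNeg (+ m) q)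

-- Inequalities are proved by exhibiting their slack as a nonnegative combination of the given slacks.
slack : ∀ {x y} → x ℤ.≤ y → + 0 ℤ.≤ y ℤ.- x
slack = ℤP.i≤j⇒0≤j-i

slack< : ∀ {x y} → x ℤ.< y → + 0 ℤ.≤ y ℤ.- (+ 1 ℤ.+ x)
slack< x<y = slack (ℤP.i<j⇒suc[i]≤j x<y)

by-slack : ∀ {x y d} → + 0 ℤ.≤ d → d ≡ y ℤ.- x → x ℤ.≤ y
by-slack p refl = ℤP.0≤i-j⇒j≤i p

by-slack< : ∀ {x y d} → + 0 ℤ.≤ d → d ≡ y ℤ.- (+ 1 ℤ.+ x) → x ℤ.< y
by-slack< p refl = ℤP.suc[i]≤j⇒i<j (ℤP.0≤i-j⇒j≤i p)

0≤pos : ∀ n → + 0 ℤ.≤ + n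
0≤pos n = ℤ.+≤+ z≤n

-- The weight may be negative: w = h gives the lower bound on iΓ, and w = -h the upper one.
sumℤ-≥ : ∀ w b xs → All (λ x → b ℤ.≤ w ℤ.* x) xs → + length xs ℤ.* b ℤ.≤ w ℤ.* sumℤ xs
sumℤ-≥ w b [] [] = ℤP.≤-reflexive (sym (ℤP.*-zeroʳ w))
sumℤ-≥ w b (x ∷ xs) (b≤ ∷ all) = subst₂ ℤ._≤_ (sym (ℤP.suc-* (+ length xs) b)) (sym (ℤP.*-distribˡ-+ w x (sumℤ xs))) (ℤP.+-mono-≤ b≤ (sumℤ-≥ w b xs all))

sumℤ-++ : ∀ xs ys → sumℤ (xs ++ ys) ≡ sumℤ xs ℤ.+ sumℤ ys
sumℤ-++ [] ys = sym (ℤP.+-identityˡ (sumℤ ys))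
sumℤ-++ (x ∷ xs) ys = trans (cong (ℤ._+_ x) (sumℤ-++ xs ys)) (sym (ℤP.+-assoc x (sumℤ xs) (sumℤ ys)))

Sumset-+ : ∀ {Γ i j x y} → Sumset i Γ x → Sumset j Γ y → Sumset (i ℕ.+ j) Γ (x ℤ.+ y)
Sumset-+ (xs , refl , xs∈ , refl) (ys , refl , ys∈ , refl) = xs ++ ys , length-++ xs , AllP.++⁺ xs∈ ys∈ , sumℤ-++ xs ys

abs<⇒∣⇒≡0 : ∀ m z → z ℤ.< + m → ℤ.- z ℤ.< + m → + m ∣ z → z ≡ + 0
abs<⇒∣⇒≡0 m (+ zero) _ _ _ = refl
abs<⇒∣⇒≡0 m (+ suc n) (ℤ.+<+ lt) _ m∣ = contradiction (ℕD.∣⇒≤ m∣) (ℕP.<⇒≱ lt)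
abs<⇒∣⇒≡0 m -[1+ n ] _ (ℤ.+<+ lt) m∣ = contradiction (ℕD.∣⇒≤ m∣) (ℕP.<⇒≱ lt)

+∣ceiling∣ : ∀ x d → ℤ.- + suc d ℤ.< x → + ℤ.∣ ceiling (x // suc d) ∣ ≡ ceiling (x // suc d)
+∣ceiling∣ x d lt = ℤP.0≤i⇒+∣i∣≡i (ℤP.≮⇒≥ λ lt′ → ℤP.<⇒≱ lt
  (subst (x ℤ.≤_) (lem (+ suc d)) (ceiling-//≤⁻ (ℤ.- + 1) x d (<suc⇒≤ {ceiling (x // suc d)} {ℤ.- + 1} lt′))))
  where
  lem : ∀ m → ℤ.- + 1 ℤ.* m ≡ ℤ.- m
  lem = ℤ-solve

∣ceiling∣≤⇔ : ∀ x d → ℤ.- + suc d ℤ.< x → ∀ j → ℤ.∣ ceiling (x // suc d) ∣ ℕ.≤ j ⇔ x ℤ.≤ + j ℤ.* + suc d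
∣ceiling∣≤⇔ x d lt j = mk⇔
  (λ le → ceiling-//≤⁻ (+ j) x d (subst (ℤ._≤ + j) (+∣ceiling∣ x d lt) (ℤ.+≤+ le)))
  (λ le → ℤP.drop‿+≤+ (subst (ℤ._≤ + j) (sym (+∣ceiling∣ x d lt)) (ceiling-//≤ (+ j) x d le)))

-≤⇔ : ∀ c l x → c ℤ.- l ℤ.≤ x ⇔ c ℤ.≤ l ℤ.+ x
-≤⇔ c l x = mk⇔ (to c l x) (from c l x)
  where
  to : ∀ c l x → c ℤ.- l ℤ.≤ x → c ℤ.≤ l ℤ.+ x
  to c l x p = by-slack (slack p) (lem c l x)
    where
    lem : ∀ c l x → x ℤ.- (c ℤ.- l) ≡ l ℤ.+ x ℤ.- c
    lem = ℤ-solve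
  from : ∀ c l x → c ℤ.≤ l ℤ.+ x → c ℤ.- l ℤ.≤ x
  from c l x p = by-slack (slack p) (lem c l x)
    where
    lem : ∀ c l x → l ℤ.+ x ℤ.- c ≡ x ℤ.- (c ℤ.- l)
    lem = ℤ-solve

<+⇒-< : ∀ l c m → l ℤ.< c ℤ.+ m → ℤ.- m ℤ.< c ℤ.- l
<+⇒-< l c m p = by-slack< (slack< p) (lem l c m)
  where
  lem : ∀ l c m → c ℤ.+ m ℤ.- (+ 1 ℤ.+ l) ≡ c ℤ.- l ℤ.- (+ 1 ℤ.+ ℤ.- m)
  lem = ℤ-solve

+-cancelʳ-< : ∀ x y z → x ℤ.+ z ℤ.< y ℤ.+ z → x ℤ.< y
+-cancelʳ-< x y z p = by-slack< (slack< p) (lem x y z)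
  where
  lem : ∀ x y z → y ℤ.+ z ℤ.- (+ 1 ℤ.+ (x ℤ.+ z)) ≡ y ℤ.- (+ 1 ℤ.+ x)
  lem = ℤ-solve

+-cancelˡ : ∀ x y z → x ℤ.+ y ≡ x ℤ.+ z → y ≡ z
+-cancelˡ x y z e = trans (sym (lem x y)) (trans (cong (λ w → ℤ.- x ℤ.+ w) e) (lem x z))
  where
  lem : ∀ x y → ℤ.- x ℤ.+ (x ℤ.+ y) ≡ y
  lem = ℤ-solve

suc-multiple : ∀ l j m → l ℤ.+ (+ 1 ℤ.+ j) ℤ.* m ≡ l ℤ.+ j ℤ.* m ℤ.+ m
suc-multiple = ℤ-solve

module Semigroup (m-1 : ℕ) (c : ℤ) (Γ : ℤ → Set)
  (m<c : + suc m-1 ℤ.< c) (m<Γ : ∀ γ → Γ γ → + suc m-1 ℤ.< γ) where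

  m : ℕ
  m = suc m-1

  Rep : ℕ → ℤ → ℕ → ℤ → Set
  Rep i λ' j x = Sumset i Γ λ' × x ≡ λ' ℤ.+ + j ℤ.* + m

  Rep-∃ : ℤ → Set
  Rep-∃ x = ∃ λ i → ∃ λ λ' → ∃ λ j → Rep i λ' j x

  Gen≥m : ∀ {x} → Gen m Γ c x → + m ℤ.≤ x
  Gen≥m (inj₁ refl) = ℤP.≤-refl
  Gen≥m (inj₂ (inj₁ γ∈)) = ℤP.<⇒≤ (m<Γ _ γ∈)
  Gen≥m (inj₂ (inj₂ c≤x)) = ℤP.≤-trans (ℤP.<⇒≤ m<c) c≤x

  0≤sum : ∀ {gs} → All (Gen m Γ c) gs → + 0 ℤ.≤ sumℤ gs
  0≤sum [] = ℤP.≤-refl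
  0≤sum (g ∷ gs) = 0≤+ (ℤP.≤-trans (0≤pos m) (Gen≥m g)) (0≤sum gs)

  InS-pos⇒≥m : ∀ {x} → + 0 ℤ.< x → InS m Γ c x → + m ℤ.≤ x
  InS-pos⇒≥m 0<x ([] , _ , refl) = contradiction 0<x (ℤP.<-irrefl refl)
  InS-pos⇒≥m 0<x (g ∷ gs , g∈ ∷ gs∈ , refl) = subst (ℤ._≤ g ℤ.+ sumℤ gs) (ℤP.+-identityʳ (+ m)) (ℤP.+-mono-≤ (Gen≥m g∈) (0≤sum gs∈))

  InS-≥c : ∀ {x} → c ℤ.≤ x → InS m Γ c x
  InS-≥c {x} c≤x = [ x ] , inj₂ (inj₂ c≤x) ∷ [] , ℤP.+-identityʳ x

  sum-long⇒¬Primitive : ∀ {gs} → 2 ℕ.≤ length gs → All (Gen m Γ c) gs → ¬ Primitive m Γ c (sumℤ gs)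
  sum-long⇒¬Primitive {g₁ ∷ g₂ ∷ gs} _ (g₁∈ ∷ g₂∈ ∷ gs∈) (_ , _ , indec) = indec
    (g₁ , g₂ ℤ.+ sumℤ gs , pos g₁∈ , ℤP.<-≤-trans (pos g₂∈) (subst (ℤ._≤ g₂ ℤ.+ sumℤ gs) (ℤP.+-identityʳ g₂) (ℤP.+-monoʳ-≤ g₂ (0≤sum gs∈)))
    , ([ g₁ ] , g₁∈ ∷ [] , ℤP.+-identityʳ g₁) , (g₂ ∷ gs , g₂∈ ∷ gs∈ , refl) , refl)
    where
    pos : ∀ {x} → Gen m Γ c x → + 0 ℤ.< x
    pos g = ℤP.<-≤-trans (ℤ.+<+ (s≤s z≤n)) (Gen≥m g)
  sum-long⇒¬Primitive {_ ∷ []} (s≤s ()) _ _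

  Rep⇒gens : ∀ {i λ' x} j → Rep i λ' j x → ∃ λ gs → length gs ≡ i ℕ.+ j × All (Gen m Γ c) gs × sumℤ gs ≡ x
  Rep⇒gens {i} {λ'} zero ((xs , refl , xs∈ , refl) , refl) =
    xs , sym (ℕP.+-identityʳ _) , All.map (inj₂ ∘ inj₁) xs∈ , sym (trans (cong (ℤ._+_ (sumℤ xs)) (ℤP.*-zeroˡ (+ m))) (ℤP.+-identityʳ _))
  Rep⇒gens {i} {λ'} (suc j) (s , refl) with Rep⇒gens j (s , refl)
  ... | gs , len , gs∈ , eq = + m ∷ gs , trans (cong suc len) (sym (ℕP.+-suc i j)) , inj₁ refl ∷ gs∈ ,
    trans (cong (ℤ._+_ (+ m)) eq) (lem λ' (+ j) (+ m))
    where
    lem : ∀ l j m → m ℤ.+ (l ℤ.+ j ℤ.* m) ≡ l ℤ.+ (+ 1 ℤ.+ j) ℤ.* m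
    lem = ℤ-solve

  Rep⇒InS : ∀ {i λ' j x} → Rep i λ' j x → InS m Γ c x
  Rep⇒InS {j = j} rep with Rep⇒gens j rep
  ... | gs , _ , gs∈ , eq = gs , gs∈ , eq

  -- A single generator ≥ c already lifts the sum to c, all others being nonnegative. Without one,
  -- only copies of m and elements of Γ are left to be collected.
  gens⇒Rep : ∀ {gs} → All (Gen m Γ c) gs → c ℤ.≤ sumℤ gs ⊎ Rep-∃ (sumℤ gs)
  gens⇒Rep [] = inj₂ (0 , + 0 , 0 , ([] , refl , [] , refl) , refl)
  gens⇒Rep {g ∷ gs} (g∈ ∷ gs∈) with g∈ | gens⇒Rep gs∈
  ... | inj₂ (inj₂ c≤g) | _ = inj₁ (subst (ℤ._≤ g ℤ.+ sumℤ gs) (ℤP.+-identityʳ c) (ℤP.+-mono-≤ c≤g (0≤sum gs∈)))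
  ... | _ | inj₁ c≤ = inj₁ (subst (ℤ._≤ g ℤ.+ sumℤ gs) (ℤP.+-identityˡ c) (ℤP.+-mono-≤ (ℤP.≤-trans (0≤pos m) (Gen≥m g∈)) c≤))
  ... | inj₁ refl | inj₂ (i , λ' , j , s , eq) = inj₂ (i , λ' , suc j , s , trans (cong (ℤ._+_ (+ m)) eq) (lem λ' (+ j) (+ m)))
    where
    lem : ∀ l j m → m ℤ.+ (l ℤ.+ j ℤ.* m) ≡ l ℤ.+ (+ 1 ℤ.+ j) ℤ.* m
    lem = ℤ-solve
  ... | inj₂ (inj₁ γ∈) | inj₂ (i , λ' , j , (xs , len , xs∈ , refl) , eq) =
    inj₂ (suc i , g ℤ.+ sumℤ xs , j , (g ∷ xs , cong suc len , γ∈ ∷ xs∈ , refl) , trans (cong (ℤ._+_ g) eq) (sym (ℤP.+-assoc g (sumℤ xs) (+ j ℤ.* + m))))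

  InS⇒Rep : ∀ {x} → x ℤ.< c → InS m Γ c x → Rep-∃ x
  InS⇒Rep x<c (gs , gs∈ , refl) with gens⇒Rep gs∈
  ... | inj₁ c≤x = contradiction c≤x (ℤP.<⇒≱ x<c)
  ... | inj₂ rep = rep

  Rep-+ : ∀ {x y} → Rep-∃ x → Rep-∃ y → Rep-∃ (x ℤ.+ y)
  Rep-+ (i , λ₁ , j , s , refl) (i′ , λ₂ , j′ , s′ , refl) =
    i ℕ.+ i′ , λ₁ ℤ.+ λ₂ , j ℕ.+ j′ , Sumset-+ s s′ , lem λ₁ λ₂ (+ j) (+ j′) (+ m)
    where
    lem : ∀ l l′ j j′ m → l ℤ.+ j ℤ.* m ℤ.+ (l′ ℤ.+ j′ ℤ.* m) ≡ l ℤ.+ l′ ℤ.+ (j ℤ.+ j′) ℤ.* m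
    lem = ℤ-solve

  -- The number of copies of m that carry λ to c or beyond. For λ < c + m the ceiling is nonnegative
  -- and the absolute value is faithful; `J` is evaluated only there.
  J : ℤ → ℕ
  J λ' = ℤ.∣ ceiling ((c ℤ.- λ') // m) ∣

  module _ (λ' : ℤ) (λ<c+m : λ' ℤ.< c ℤ.+ + m) where

    private
      -m<c-λ : ℤ.- + m ℤ.< c ℤ.- λ'
      -m<c-λ = <+⇒-< λ' c (+ m) λ<c+m

    +J : + J λ' ≡ ceiling ((c ℤ.- λ') // m)
    +J = +∣ceiling∣ (c ℤ.- λ') m-1 -m<c-λ

    J≤⇔ : ∀ j → J λ' ℕ.≤ j ⇔ c ℤ.≤ λ' ℤ.+ + j ℤ.* + m
    J≤⇔ j = ⇔.trans (∣ceiling∣≤⇔ (c ℤ.- λ') m-1 -m<c-λ j)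
      (-≤⇔ c λ' (+ j ℤ.* + m))

    c≤λ+Jm : c ℤ.≤ λ' ℤ.+ + J λ' ℤ.* + m
    c≤λ+Jm = Equivalence.to (J≤⇔ (J λ')) ℕP.≤-refl

    <J⇒<c : ∀ {j} → j ℕ.< J λ' → λ' ℤ.+ + j ℤ.* + m ℤ.< c
    <J⇒<c {j} lt = ℤP.≰⇒> λ le → ℕP.<⇒≱ lt (Equivalence.from (J≤⇔ j) le)

    <c⇒<J : ∀ {j} → λ' ℤ.+ + j ℤ.* + m ℤ.< c → j ℕ.< J λ'
    <c⇒<J {j} lt = ℕP.≰⇒> λ le → ℤP.<⇒≱ lt (Equivalence.to (J≤⇔ j) le)

    ≤J⇒<c+m : ∀ j → j ℕ.≤ J λ' → λ' ℤ.+ + j ℤ.* + m ℤ.< c ℤ.+ + m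
    ≤J⇒<c+m zero _ = subst (ℤ._< c ℤ.+ + m) (sym (trans (cong (ℤ._+_ λ') (ℤP.*-zeroˡ (+ m))) (ℤP.+-identityʳ λ'))) λ<c+m
    ≤J⇒<c+m (suc j) j<J = subst (ℤ._< c ℤ.+ + m) (sym (suc-multiple λ' (+ j) (+ m))) (ℤP.+-monoˡ-< (+ m) (<J⇒<c j<J))

    J-unique : ∀ j → c ℤ.≤ λ' ℤ.+ + j ℤ.* + m → λ' ℤ.+ + j ℤ.* + m ℤ.< c ℤ.+ + m → j ≡ J λ'
    J-unique zero c≤ _ = sym (ℕP.n≤0⇒n≡0 (Equivalence.from (J≤⇔ 0) c≤))
    J-unique (suc j) c≤ <c+m = ℕP.≤-antisym (<c⇒<J (+-cancelʳ-< (λ' ℤ.+ + j ℤ.* + m) c (+ m) (subst (ℤ._< c ℤ.+ + m) (suc-multiple λ' (+ j) (+ m)) <c+m))) (Equivalence.from (J≤⇔ (suc j)) c≤)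

-- Counting elements of S

neg-≤-neg-* : ∀ h x y → h ℤ.* x ℤ.< y → ℤ.- (y ℤ.- + 1) ℤ.≤ ℤ.- h ℤ.* x
neg-≤-neg-* h x y p = by-slack (slack< p) (lem h x y)
  where
  lem : ∀ h x y → y ℤ.- (+ 1 ℤ.+ h ℤ.* x) ≡ ℤ.- h ℤ.* x ℤ.- ℤ.- (y ℤ.- + 1)
  lem = ℤ-solve

neg-*-cancel-≤ : ∀ i u h x → i ℤ.* ℤ.- u ℤ.≤ ℤ.- h ℤ.* x → h ℤ.* x ℤ.≤ i ℤ.* u
neg-*-cancel-≤ i u h x p = by-slack (slack p) (lem i u h x)
  where
  lem : ∀ i u h x → ℤ.- h ℤ.* x ℤ.- i ℤ.* ℤ.- u ≡ i ℤ.* u ℤ.- h ℤ.* x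
  lem = ℤ-solve

<-pred⇒≤ : ∀ x y → x ℤ.≤ y ℤ.- + 1 → x ℤ.< y
<-pred⇒≤ x y p = by-slack< (slack p) (lem x y)
  where
  lem : ∀ x y → y ℤ.- + 1 ℤ.- x ≡ y ℤ.- (+ 1 ℤ.+ x)
  lem = ℤ-solve

m≤c+m-1 : ∀ m c → m ℤ.< c → + 0 ℤ.≤ m → + 0 ℤ.≤ c ℤ.+ m ℤ.- + 1
m≤c+m-1 m c m<c 0≤m = by-slack (0≤+ (slack< m<c) (0≤+ 0≤m 0≤m)) (lem m c)
  where
  lem : ∀ m c → c ℤ.- (+ 1 ℤ.+ m) ℤ.+ (m ℤ.+ m) ≡ c ℤ.+ m ℤ.- + 1 ℤ.- + 0
  lem = ℤ-solve

-- This is where h ≥ 2 enters: c + m < 2 c ≤ h c. It yields that Γ lies below c.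
scaled-< : ∀ h x c m → + 2 ℤ.≤ h → + 0 ℤ.≤ c → m ℤ.< c → h ℤ.* x ℤ.< c ℤ.+ m → h ℤ.* x ℤ.< h ℤ.* c
scaled-< h x c m 2≤h 0≤c m<c p = by-slack< (0≤+ (0≤+ (slack< p) (slack m<c′)) (0≤* (slack 2≤h) 0≤c)) (lem h x c m)
  where
  m<c′ = ℤP.<⇒≤ m<c
  lem : ∀ h x c m → c ℤ.+ m ℤ.- (+ 1 ℤ.+ h ℤ.* x) ℤ.+ (c ℤ.- m) ℤ.+ (h ℤ.- + 2) ℤ.* c ≡ h ℤ.* c ℤ.- (+ 1 ℤ.+ h ℤ.* x)
  lem = ℤ-solve

scaled-separation : ∀ h i c m x y → i ℤ.≤ h → + 1 ℤ.≤ m → h ℤ.* x ℤ.≤ i ℤ.* (c ℤ.+ m ℤ.- + 1) → i ℤ.* c ℤ.≤ h ℤ.* y →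
  h ℤ.* (x ℤ.- y) ℤ.≤ h ℤ.* (m ℤ.- + 1)
scaled-separation h i c m x y i≤h 1≤m px py = by-slack (0≤+ (0≤+ (slack px) (slack py)) (0≤* (slack i≤h) (slack 1≤m))) (lem h i c m x y)
  where
  lem : ∀ h i c m x y → i ℤ.* (c ℤ.+ m ℤ.- + 1) ℤ.- h ℤ.* x ℤ.+ (h ℤ.* y ℤ.- i ℤ.* c) ℤ.+ (h ℤ.- i) ℤ.* (m ℤ.- + 1)
    ≡ h ℤ.* (m ℤ.- + 1) ℤ.- h ℤ.* (x ℤ.- y)
  lem = ℤ-solve

multiple-difference : ∀ x y j k m → x ℤ.+ j ℤ.* m ≡ y ℤ.+ k ℤ.* m → x ℤ.- y ≡ (k ℤ.- j) ℤ.* m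
multiple-difference x y j k m eq = trans (lem x y (j ℤ.* m)) (trans (cong (λ z → z ℤ.- j ℤ.* m ℤ.- y) eq) (lem′ y j k m))
  where
  lem : ∀ x y z → x ℤ.- y ≡ x ℤ.+ z ℤ.- z ℤ.- y
  lem = ℤ-solve
  lem′ : ∀ y j k m → y ℤ.+ k ℤ.* m ℤ.- j ℤ.* m ℤ.- y ≡ (k ℤ.- j) ℤ.* m
  lem′ = ℤ-solve

module Counting (m-1 g : ℕ) (c : ℤ) (Γ : ℤ → Set)
  (1≤g : 1 ℕ.≤ g)
  (m<c : + suc m-1 ℤ.< c) (m<Γ : ∀ γ → Γ γ → + suc m-1 ℤ.< γ)
  (c≤hΓ : ∀ γ → Γ γ → c ℤ.≤ + suc g ℤ.* γ) (hΓ<c+m : ∀ γ → Γ γ → + suc g ℤ.* γ ℤ.< c ℤ.+ + suc m-1)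
  (γ₀ : ℤ) (G₀ : List ℤ) (G! : Unique (γ₀ ∷ G₀)) (G⇔ : ∀ γ → γ ∈ γ₀ ∷ G₀ ⇔ Γ γ)
  (can : Canonical (suc m-1) Γ c) (cf : CollisionFree (suc g) (suc m-1) Γ)
  where

  open Semigroup m-1 c Γ m<c m<Γ

  h : ℕ
  h = suc g
  G : List ℤ
  G = γ₀ ∷ G₀

  0≤c : + 0 ℤ.≤ c
  0≤c = ℤP.≤-trans (0≤pos m) (ℤP.<⇒≤ m<c)

  Γ<c : ∀ γ → Γ γ → γ ℤ.< c
  Γ<c γ γ∈ = ℤP.*-cancelˡ-<-nonNeg (+ h) (scaled-< (+ h) γ c (+ m) (ℤ.+≤+ (s≤s 1≤g)) 0≤c m<c (hΓ<c+m γ γ∈))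

  Sumset-lower : ∀ {i x} → Sumset i Γ x → + i ℤ.* c ℤ.≤ + h ℤ.* x
  Sumset-lower (xs , refl , xs∈ , refl) = sumℤ-≥ (+ h) c xs (All.map (c≤hΓ _) xs∈)

  Sumset-upper : ∀ {i x} → Sumset i Γ x → + h ℤ.* x ℤ.≤ + i ℤ.* (c ℤ.+ + m ℤ.- + 1)
  Sumset-upper {i} {x} (xs , refl , xs∈ , refl) = neg-*-cancel-≤ (+ i) (c ℤ.+ + m ℤ.- + 1) (+ h) x
    (sumℤ-≥ (ℤ.- + h) (ℤ.- (c ℤ.+ + m ℤ.- + 1)) xs (All.map (λ {γ} γ∈ → neg-≤-neg-* (+ h) γ (c ℤ.+ + m) (hΓ<c+m γ γ∈)) xs∈))

  Sumset<c+m : ∀ {i x} → i ℕ.≤ h → Sumset i Γ x → x ℤ.< c ℤ.+ + m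
  Sumset<c+m {i} {x} i≤h s = <-pred⇒≤ x (c ℤ.+ + m) (ℤP.*-cancelˡ-≤-pos x (c ℤ.+ + m ℤ.- + 1) (+ h)
    (ℤP.≤-trans (Sumset-upper s) (ℤP.*-monoʳ-≤-nonNeg (c ℤ.+ + m ℤ.- + 1) {{ℤ.nonNegative (m≤c+m-1 (+ m) c m<c (0≤pos m))}} (ℤ.+≤+ i≤h))))

  c≤Sumset : ∀ {i x} → h ℕ.≤ i → Sumset i Γ x → c ℤ.≤ x
  c≤Sumset {i} {x} h≤i s = ℤP.*-cancelˡ-≤-pos c x (+ h)
    (ℤP.≤-trans (ℤP.*-monoʳ-≤-nonNeg c {{ℤ.nonNegative 0≤c}} (ℤ.+≤+ h≤i)) (Sumset-lower s))

  -- One summand exceeds m, and the remaining ones, at least h in number, add up to c or more. So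
  -- sizes above h are invisible below c + m.
  c+m≤Sumset : ∀ {i x} → h ℕ.< i → Sumset i Γ x → c ℤ.+ + m ℤ.≤ x
  c+m≤Sumset (s≤s h≤i) (x ∷ xs , refl , x∈ ∷ xs∈ , refl) = subst (ℤ._≤ x ℤ.+ sumℤ xs) (ℤP.+-comm (+ m) c)
    (ℤP.+-mono-≤ (ℤP.<⇒≤ (m<Γ x x∈)) (c≤Sumset h≤i (xs , refl , xs∈ , refl)))

  Rep≥ : ∀ {i λ' j x} → Rep i λ' j x → λ' ℤ.≤ x
  Rep≥ {λ' = λ'} {j} (_ , refl) = subst (ℤ._≤ λ' ℤ.+ + j ℤ.* + m) (ℤP.+-identityʳ λ') (ℤP.+-monoʳ-≤ λ' (0≤* (0≤pos j) (0≤pos m)))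

  -- One entry per multiset of size at most h. Size h is included so that the length is s, as needed
  -- for r; such entries have `J` equal to 0 and leave k unchanged.
  P : List (ℕ × ℤ)
  P = concatMap (λ i → map (i ,_) (multisums i G)) (upTo (suc h))

  ∈P⁺ : ∀ {i λ'} → i ℕ.≤ h → Sumset i Γ λ' → (i , λ') ∈ P
  ∈P⁺ {i} {λ'} i≤h s = ∈-concatMap⁺ (λ i → map (i ,_) (multisums i G))
    (lose (∈-upTo⁺ (s≤s i≤h)) (∈-map⁺ (i ,_) (Equivalence.from (∈-multisums⇔ G G⇔ i λ') s)))

  ∈P⁻ : ∀ {p} → p ∈ P → proj₁ p ℕ.≤ h × Sumset (proj₁ p) Γ (proj₂ p)
  ∈P⁻ p∈ with find (∈-concatMap⁻ (λ i → map (i ,_) (multisums i G)) {upTo (suc h)} p∈)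
  ... | i , i∈ , p∈′ with ∈-map⁻ (i ,_) p∈′
  ...   | λ' , λ∈ , refl = ℕP.≤-pred (∈-upTo⁻ i∈) , Equivalence.to (∈-multisums⇔ G G⇔ i λ') λ∈

  P! : Unique P
  P! = concatMap-! (Unique.upTo⁺ (suc h))
    (λ {i} i∈ → Unique.map⁺ (cong proj₂) (multisums-!-≤ γ₀ G₀ (ℕP.≤⇒≤′ (ℕP.≤-pred (∈-upTo⁻ i∈))) (IsBh⇒! G G! G⇔ h (proj₁ cf))))
    (λ {i} {j} _ _ p q → trans (sym (cong proj₁ (proj₂ (proj₂ (∈-map⁻ (i ,_) p))))) (cong proj₁ (proj₂ (proj₂ (∈-map⁻ (j ,_) q)))))

  Sumset-separated : ∀ {i x y} → i ℕ.≤ h → Sumset i Γ x → Sumset i Γ y → x ℤ.- y ℤ.< + m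
  Sumset-separated {i} {x} {y} i≤h sx sy = <-pred⇒≤ (x ℤ.- y) (+ m) (ℤP.*-cancelˡ-≤-pos (x ℤ.- y) (+ m ℤ.- + 1) (+ h)
    (scaled-separation (+ h) (+ i) c (+ m) x y (ℤ.+≤+ i≤h) (ℤ.+≤+ (s≤s z≤n)) (Sumset-upper sx) (Sumset-lower sy)))

  -- Sizes i ≠ j are covered by collision-freeness. For equal sizes the difference is a multiple of
  -- m of absolute value below m.
  P-separated : ∀ {p q} → p ∈ P → q ∈ P → + m ∣ proj₂ p ℤ.- proj₂ q → p ≡ q
  P-separated {i , x} {j , y} p∈ q∈ m∣ with ∈P⁻ p∈ | ∈P⁻ q∈ | i ℕ.≟ j
  ... | i≤h , sx | j≤h , sy | no i≢j = contradiction m∣ (proj₂ cf i j x y i≤h j≤h i≢j sx sy)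
  ... | i≤h , sx | _ , sy | yes refl = cong (i ,_) (ℤP.i-j≡0⇒i≡j x y (abs<⇒∣⇒≡0 m (x ℤ.- y) (Sumset-separated i≤h sx sy)
     (subst (ℤ._< + m) (lem x y) (Sumset-separated i≤h sy sx)) m∣))
    where
    lem : ∀ x y → y ℤ.- x ≡ ℤ.- (x ℤ.- y)
    lem = ℤ-solve

  shift : ℕ × ℤ → ℕ → ℤ
  shift p j = proj₂ p ℤ.+ + j ℤ.* + m

  shift-injective : ∀ {p q} j k → p ∈ P → q ∈ P → shift p j ≡ shift q k → p ≡ q
  shift-injective {p} {q} j k p∈ q∈ eq = P-separated p∈ q∈ (ℕD.divides ℤ.∣ + k ℤ.- + j ∣
    (trans (cong ℤ.∣_∣ (multiple-difference (proj₂ p) (proj₂ q) (+ j) (+ k) (+ m) eq)) (ℤP.abs-* (+ k ℤ.- + j) (+ m))))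

  shift-injectiveʳ : ∀ p {j k} → shift p j ≡ shift p k → j ≡ k
  shift-injectiveʳ p {j} {k} eq = ℤP.+-injective (ℤP.*-cancelʳ-≡ (+ j) (+ k) (+ m) (+-cancelˡ (proj₂ p) _ _ eq))

  below : List ℤ
  below = concatMap (λ p → map (shift p) (upTo (J (proj₂ p)))) P

  below! : Unique below
  below! = concatMap-! P!
    (λ {p} _ → Unique.map⁺ (shift-injectiveʳ p) (Unique.upTo⁺ (J (proj₂ p))))
    (λ {p} {q} p∈ q∈ z∈p z∈q → let (j , _ , eq) = ∈-map⁻ (shift p) z∈p ; (k , _ , eq′) = ∈-map⁻ (shift q) z∈q in
       shift-injective j k p∈ q∈ (trans (sym eq) eq′))

  ∈below : ∀ x → x ∈ below ⇔ (InS m Γ c x × x ℤ.< c)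
  ∈below x = mk⇔ to from
    where
    to : x ∈ below → InS m Γ c x × x ℤ.< c
    to x∈ with find (∈-concatMap⁻ (λ p → map (shift p) (upTo (J (proj₂ p)))) {P} x∈)
    ... | p , p∈ , x∈′ with ∈-map⁻ (shift p) x∈′ | ∈P⁻ p∈
    ...   | j , j∈ , refl | i≤h , s = Rep⇒InS {j = j} (s , refl) , <J⇒<c (proj₂ p) (Sumset<c+m i≤h s) {j} (∈-upTo⁻ j∈)
    from : InS m Γ c x × x ℤ.< c → x ∈ below
    from (x∈S , x<c) with InS⇒Rep x<c x∈S
    ... | i , λ' , j , s , refl = ∈-concatMap⁺ (λ p → map (shift p) (upTo (J (proj₂ p))))
      (lose (∈P⁺ i≤h s) (∈-map⁺ (shift (i , λ')) (∈-upTo⁺ (<c⇒<J λ' (Sumset<c+m i≤h s) {j} x<c))))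
      where
      i≤h : i ℕ.≤ h
      i≤h = ℕP.<⇒≤ (ℕP.≰⇒> λ h≤i → ℤP.<⇒≱ x<c (ℤP.≤-trans (c≤Sumset h≤i s) (Rep≥ {j = j} (s , refl))))

  k-count : ∀ {k} → IsCard (λ x → InS m Γ c x × x ℤ.< c) k → sum (map (J ∘ proj₂) P) ≡ k
  k-count card = trans (sym (trans (length-concatMap (λ p → map (shift p) (upTo (J (proj₂ p)))) P)
     (cong sum (map-cong (λ p → trans (length-map (shift p) (upTo (J (proj₂ p)))) (length-upTo (J (proj₂ p)))) P))))
    (IsCard-length card below! ∈below)

  -- A primitive element is a single generator, and below c this is m or an element of Γ; canonicity
  -- gives the converse. The extra 1 is m itself, so |Γ| = ℓ - 1.
  ℓ-count : ∀ {ℓ} → IsCard (λ x → Primitive m Γ c x × x ℤ.< c) ℓ → suc (length G) ≡ ℓ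
  ℓ-count card = IsCard-length card (All.tabulate (λ γ∈ m≡γ → ℤP.<-irrefl m≡γ (m<Γ _ (Equivalence.to (G⇔ _) γ∈))) ∷ G!) (λ x → mk⇔ (to x) (from x))
    where
    to : ∀ x → x ∈ + m ∷ G → Primitive m Γ c x × x ℤ.< c
    to x (here refl) = proj₁ can , m<c
    to x (there γ∈) = proj₁ (proj₂ can) x (Equivalence.to (G⇔ x) γ∈) , Γ<c x (Equivalence.to (G⇔ x) γ∈)
    from : ∀ x → Primitive m Γ c x × x ℤ.< c → x ∈ + m ∷ G
    from x (prim@(0<x , (gs , gs∈ , eq) , _) , x<c) = go gs gs∈ eq
      where
      go : ∀ gs → All (Gen m Γ c) gs → sumℤ gs ≡ x → x ∈ + m ∷ G
      go [] _ eq = contradiction 0<x (ℤP.<-irrefl eq)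
      go (g ∷ []) (g∈ ∷ []) eq with trans (sym (ℤP.+-identityʳ g)) eq | g∈
      ... | refl | inj₁ refl = here refl
      ... | refl | inj₂ (inj₁ γ∈) = there (Equivalence.from (G⇔ _) γ∈)
      ... | refl | inj₂ (inj₂ c≤x) = contradiction c≤x (ℤP.<⇒≱ x<c)
      go (g₁ ∷ g₂ ∷ gs) gs∈ eq = contradiction (subst (Primitive m Γ c) (sym eq) prim) (sum-long⇒¬Primitive (s≤s (s≤s z≤n)) gs∈)

  -- The representative in [c, c + m) of the class of λ modulo m.
  top : ℕ × ℤ → ℤ
  top p = shift p (J (proj₂ p))

  c≤top : ∀ {p} → p ∈ P → c ℤ.≤ top p
  c≤top {p} p∈ = let i≤h , s = ∈P⁻ p∈ in c≤λ+Jm (proj₂ p) (Sumset<c+m i≤h s)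

  top<c+m : ∀ {p} → p ∈ P → top p ℤ.< c ℤ.+ + m
  top<c+m {p} p∈ = let i≤h , s = ∈P⁻ p∈ in ≤J⇒<c+m (proj₂ p) (Sumset<c+m i≤h s) (J (proj₂ p)) ℕP.≤-refl

  -- The representative uses i + `J` generators. For i = 0 two copies of m are needed because m < c,
  -- and for i = 1 at least one because γ < c.
  top-decomposable : ∀ {p} → p ∈ P → 2 ℕ.≤ proj₁ p ℕ.+ J (proj₂ p)
  top-decomposable {zero , λ'} p∈ with ∈P⁻ p∈
  ... | i≤h , ([] , _ , _ , refl) = ℕP.≰⇒> λ J≤1 → ℤP.<⇒≱ m<c
    (ℤP.≤-trans (c≤top p∈) (ℤP.≤-trans (ℤP.≤-reflexive (ℤP.+-identityˡ _)) (subst (+ J (+ 0) ℤ.* + m ℤ.≤_) (ℤP.*-identityˡ (+ m)) (ℤP.*-monoʳ-≤-nonNeg (+ m) (ℤ.+≤+ J≤1)))))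
  top-decomposable {suc zero , λ'} p∈ with ∈P⁻ p∈
  ... | i≤h , (γ ∷ [] , _ , γ∈ ∷ [] , refl) = s≤s (<c⇒<J (γ ℤ.+ + 0) (Sumset<c+m i≤h (γ ∷ [] , refl , γ∈ ∷ [] , refl)) {0}
    (subst (ℤ._< c) (sym (lem γ (+ m))) (Γ<c γ γ∈)))
    where
    lem : ∀ γ m → γ ℤ.+ + 0 ℤ.+ + 0 ℤ.* m ≡ γ
    lem = ℤ-solve
  top-decomposable {suc (suc i) , λ'} p∈ = s≤s (s≤s z≤n)

  top-¬Primitive : ∀ {p} → p ∈ P → ¬ Primitive m Γ c (top p)
  top-¬Primitive {p} p∈ prim with Rep⇒gens (J (proj₂ p)) (proj₂ (∈P⁻ p∈) , refl)
  ... | gs , len , gs∈ , eq = sum-long⇒¬Primitive (subst (2 ℕ.≤_) (sym len) (top-decomposable p∈)) gs∈ (subst (Primitive m Γ c) (sym eq) prim)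

  Rep⇒top : ∀ {x} → c ℤ.≤ x → x ℤ.< c ℤ.+ + m → Rep-∃ x → x ∈ map top P
  Rep⇒top {x} c≤x x<c+m (i , λ' , j , s , eq) = subst (_∈ map top P)
    (trans (cong (shift (i , λ')) (sym (J-unique λ' (Sumset<c+m i≤h s) j (subst (c ℤ.≤_) eq c≤x) (subst (ℤ._< c ℤ.+ + m) eq x<c+m)))) (sym eq))
    (∈-map⁺ top (∈P⁺ i≤h s))
    where
    i≤h : i ℕ.≤ h
    i≤h = ℕP.≮⇒≥ λ h<i → ℤP.<⇒≱ x<c+m (ℤP.≤-trans (c+m≤Sumset h<i s) (Rep≥ {j = j} (s , eq)))

  sum<c+m⇒<c : ∀ y z → + m ℤ.≤ z → y ℤ.+ z ℤ.< c ℤ.+ + m → y ℤ.< c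
  sum<c+m⇒<c y z m≤z lt = +-cancelʳ-< y c (+ m) (ℤP.≤-<-trans (ℤP.+-monoʳ-≤ y m≤z) lt)

  -- If x = y + z, both parts are at least m, hence both lie below c and have representations
  -- without generators ≥ c; so does their sum.
  Primitive⊎top : ∀ {x} → c ℤ.≤ x → x ℤ.< c ℤ.+ + m → Primitive m Γ c x ⊎ x ∈ map top P
  Primitive⊎top {x} c≤x x<c+m with x ∈? map top P
  ... | yes x∈ = inj₂ x∈
  ... | no x∉ = inj₁ (ℤP.<-≤-trans (ℤP.<-trans (ℤ.+<+ (s≤s z≤n)) m<c) c≤x , InS-≥c c≤x ,
    λ { (y , z , 0<y , 0<z , y∈ , z∈ , refl) → x∉ (Rep⇒top c≤x x<c+m (Rep-+
          (InS⇒Rep (sum<c+m⇒<c y z (InS-pos⇒≥m 0<z z∈) x<c+m) y∈)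
          (InS⇒Rep (sum<c+m⇒<c z y (InS-pos⇒≥m 0<y y∈) (subst (ℤ._< c ℤ.+ + m) (ℤP.+-comm y z) x<c+m)) z∈))) })

  Primitive<c+m : ∀ {x} → Primitive m Γ c x → x ℤ.< c ℤ.+ + m
  Primitive<c+m {x} (_ , _ , indec) = ℤP.≰⇒> λ c+m≤x → indec
    (+ m , x ℤ.- + m , ℤ.+<+ (s≤s z≤n) , ℤP.<-≤-trans (ℤP.<-trans (ℤ.+<+ (s≤s z≤n)) m<c) (c≤ x c (+ m) c+m≤x)
    , ([ + m ] , inj₁ refl ∷ [] , ℤP.+-identityʳ (+ m)) , InS-≥c (c≤ x c (+ m) c+m≤x) , lem x (+ m))
    where
    c≤ : ∀ x c m → c ℤ.+ m ℤ.≤ x → c ℤ.≤ x ℤ.- m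
    c≤ x c m p = by-slack (slack p) (lem x c m)
      where
      lem : ∀ x c m → x ℤ.- (c ℤ.+ m) ≡ x ℤ.- m ℤ.- c
      lem = ℤ-solve
    lem : ∀ x m → x ≡ m ℤ.+ (x ℤ.- m)
    lem = ℤ-solve

  interval-card : IsCard (λ x → c ℤ.≤ x × x ℤ.< c ℤ.+ + m) m
  interval-card = record
    { elems = map (λ n → c ℤ.+ + n) (upTo m)
    ; unique = Unique.map⁺ (λ {i} {j} eq → ℤP.+-injective (+-cancelˡ c (+ i) (+ j) eq)) (Unique.upTo⁺ m)
    ; complete = λ x → mk⇔ (to x) (from x)
    ; size = trans (length-map (λ n → c ℤ.+ + n) (upTo m)) (length-upTo m) }
    where
    to : ∀ x → x ∈ map (λ n → c ℤ.+ + n) (upTo m) → c ℤ.≤ x × x ℤ.< c ℤ.+ + m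
    to x x∈ with ∈-map⁻ (λ n → c ℤ.+ + n) x∈
    ... | n , n∈ , refl = subst (ℤ._≤ c ℤ.+ + n) (ℤP.+-identityʳ c) (ℤP.+-monoʳ-≤ c (0≤pos n)) , ℤP.+-monoʳ-< c (ℤ.+<+ (∈-upTo⁻ n∈))
    from : ∀ x → c ℤ.≤ x × x ℤ.< c ℤ.+ + m → x ∈ map (λ n → c ℤ.+ + n) (upTo m)
    from x (c≤x , x<c+m) = subst (_∈ map (λ n → c ℤ.+ + n) (upTo m)) eq
      (∈-map⁺ (λ n → c ℤ.+ + n) (∈-upTo⁺ (ℤP.drop‿+<+ (+-cancelʳ-< (+ n) (+ m) c (subst₂ ℤ._<_ (sym (trans (ℤP.+-comm (+ n) c) eq)) (ℤP.+-comm c (+ m)) x<c+m)))))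
      where
      n : ℕ
      n = ℤ.∣ x ℤ.- c ∣
      lem : ∀ x c → c ℤ.+ (x ℤ.- c) ≡ x
      lem = ℤ-solve
      eq : c ℤ.+ + n ≡ x
      eq = trans (cong (ℤ._+_ c) (ℤP.0≤i⇒+∣i∣≡i (slack c≤x))) (lem x c)

  r-count : ∀ {r} → IsCard (λ x → Primitive m Γ c x × c ℤ.≤ x) r → r ℕ.+ length P ≡ m
  r-count {r} card = trans (cong₂ ℕ._+_ (sym (IsCard.size card)) (sym (length-map top P)))
    (trans (sym (length-++ R)) (IsCard-length interval-card all! (λ x → mk⇔ (to x) (from x))))
    where
    R : List ℤ
    R = IsCard.elems card
    ∈R : ∀ x → x ∈ R ⇔ (Primitive m Γ c x × c ℤ.≤ x)
    ∈R = IsCard.complete card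
    tops! : ∀ {Q} → All (_∈ P) Q → Unique Q → Unique (map top Q)
    tops! [] [] = []
    tops! {p ∷ Q} (p∈ ∷ Q∈) (p∉ ∷ Q!) = AllP.map⁺ (All.zipWith (λ { {q} (p≢q , q∈) eq → p≢q (shift-injective (J (proj₂ p)) (J (proj₂ q)) p∈ q∈ eq) }) (p∉ , Q∈)) ∷ tops! Q∈ Q!
    all! : Unique (R ++ map top P)
    all! = Unique.++⁺ (IsCard.unique card) (tops! (All.tabulate (λ p∈ → p∈)) P!) λ { {x} (x∈R , x∈top) → clash x∈R (∈-map⁻ top x∈top) }
      where
      clash : ∀ {x} → x ∈ R → ¬ (∃ λ p → p ∈ P × x ≡ top p)
      clash x∈R (p , p∈ , refl) = top-¬Primitive p∈ (proj₁ (Equivalence.to (∈R _) x∈R))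
    to : ∀ x → x ∈ R ++ map top P → c ℤ.≤ x × x ℤ.< c ℤ.+ + m
    to x x∈ with ∈-++⁻ R x∈
    ... | inj₁ x∈R = let prim , c≤x = Equivalence.to (∈R x) x∈R in c≤x , Primitive<c+m prim
    ... | inj₂ x∈top with ∈-map⁻ top x∈top
    ...   | p , p∈ , refl = c≤top p∈ , top<c+m p∈
    from : ∀ x → c ℤ.≤ x × x ℤ.< c ℤ.+ + m → x ∈ R ++ map top P
    from x (c≤x , x<c+m) with Primitive⊎top c≤x x<c+m
    ... | inj₁ prim = ∈-++⁺ˡ (Equivalence.from (∈R x) (prim , c≤x))
    ... | inj₂ x∈top = ∈-++⁺ʳ R x∈top

  length-P : length P ≡ sum (map (mch (length G)) (upTo (suc h)))
  length-P = trans (length-concatMap (λ i → map (i ,_) (multisums i G)) (upTo (suc h)))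
    (cong sum (map-cong (λ i → trans (length-map (i ,_) (multisums i G)) (length-multisums i G)) (upTo (suc h))))

  sum-over-P : ∀ (f : ℕ → ℕ) → sum (map (f ∘ proj₁) P) ≡ sum (map (λ i → f i ℕ.* mch (length G) i) (upTo (suc h)))
  sum-over-P f = trans (sum-map-concatMap (f ∘ proj₁) (λ i → map (i ,_) (multisums i G)) (upTo (suc h)))
    (cong sum (map-cong (λ i → trans (sum-map-const (f ∘ proj₁) (f i) (map (i ,_) (multisums i G))
        (λ p∈ → cong f (cong proj₁ (proj₂ (proj₂ (∈-map⁻ (i ,_) p∈))))))
      (cong (f i ℕ.*_) (trans (length-map (i ,_) (multisums i G)) (length-multisums i G)))) (upTo (suc h))))

  -- Each `J` is f or f + 1, and ω counts the entries with the excess. The Farey fractions enter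
  -- only through the bounds assumed on f.
  k-count-long : ∀ (f : ℕ → ℕ) → (∀ {p} → p ∈ P → f (proj₁ p) ℕ.≤ J (proj₂ p) × J (proj₂ p) ℕ.≤ suc (f (proj₁ p))) →
    ∀ {k ω} → IsCard (λ x → InS m Γ c x × x ℤ.< c) k →
    IsCard (λ p → proj₁ p ℕ.≤ h × Sumset (proj₁ p) Γ (proj₂ p) × f (proj₁ p) ℕ.< J (proj₂ p)) ω →
    k ≡ sum (map (λ i → f i ℕ.* mch (length G) i) (upTo (suc h))) ℕ.+ ω
  k-count-long f f≤J≤suc-f {k} {ω} card-k card-ω = begin
    k                                                                           ≡⟨ k-count card-k ⟨
    sum (map (J ∘ proj₂) P)                                                     ≡⟨ sum-map-filter long? (J ∘ proj₂) (f ∘ proj₁) P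
      (λ p∈ f<J → ℕP.≤-antisym (proj₂ (f≤J≤suc-f p∈)) f<J) (λ p∈ f≮J → ℕP.≤-antisym (ℕP.≮⇒≥ f≮J) (proj₁ (f≤J≤suc-f p∈))) ⟩
    sum (map (f ∘ proj₁) P) ℕ.+ length (filter long? P)                         ≡⟨ cong₂ ℕ._+_ (sum-over-P f)
      (IsCard-length card-ω (Unique.filter⁺ long? P!) (λ p → mk⇔
        (λ p∈ → let p∈P , long = ∈-filter⁻ long? p∈ ; i≤h , s = ∈P⁻ p∈P in i≤h , s , long)
        (λ (i≤h , s , long) → ∈-filter⁺ long? (∈P⁺ i≤h s) long))) ⟩
    sum (map (λ i → f i ℕ.* mch (length G) i) (upTo (suc h))) ℕ.+ ω             ∎
    where
    open ≡-Reasoning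
    long? : ∀ p → Dec (f (proj₁ p) ℕ.< J (proj₂ p))
    long? p = f (proj₁ p) ℕ.<? J (proj₂ p)

-- The Eliahou number

ℕℚ-sum : {A : Set} (f : A → ℕ) (xs : List A) → ℕℚ (sum (map f xs)) ≡ Σℚ (map (ℕℚ ∘ f) xs)
ℕℚ-sum f [] = refl
ℕℚ-sum f (x ∷ xs) = trans (ℕℚ-+ (f x) (sum (map f xs))) (cong (ℕℚ (f x) ℚ.+_) (ℕℚ-sum f xs))

-- The chain F m ≤ n a' m / b' < n (c + m)/h with denominators cleared; n ≥ 1 keeps it strict.
scaled-floor< : ∀ a' b' c h m n F → + 0 ℤ.≤ h → + 0 ℤ.≤ m → + 1 ℤ.≤ n → a' ℤ.* (h ℤ.* m) ℤ.< (c ℤ.+ m) ℤ.* b' → F ℤ.* b' ℤ.≤ n ℤ.* a' →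
  h ℤ.* (F ℤ.* m) ℤ.* b' ℤ.< n ℤ.* (c ℤ.+ m) ℤ.* b'
scaled-floor< a' b' c h m n F 0≤h 0≤m 1≤n p q = by-slack< (0≤+ (0≤+ (0≤* 0≤n (slack< p)) (0≤* (0≤* 0≤h 0≤m) (slack q))) (slack 1≤n)) (lem a' b' c h m n F)
  where
  0≤n : + 0 ℤ.≤ n
  0≤n = ℤP.≤-trans (ℤ.+≤+ z≤n) 1≤n
  lem : ∀ a' b' c h m n F →
    n ℤ.* ((c ℤ.+ m) ℤ.* b' ℤ.- (+ 1 ℤ.+ a' ℤ.* (h ℤ.* m))) ℤ.+ h ℤ.* m ℤ.* (n ℤ.* a' ℤ.- F ℤ.* b') ℤ.+ (n ℤ.- + 1)
    ≡ n ℤ.* (c ℤ.+ m) ℤ.* b' ℤ.- (+ 1 ℤ.+ h ℤ.* (F ℤ.* m) ℤ.* b')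
  lem = ℤ-solve

-- Here h is written i + n, so that the slack identity holds in a polynomial ring. The conclusion
-- says F < J + 1, that is F ≤ J.
scaled-lower : ∀ c m i n l J F → + 0 ℤ.≤ i → + 0 ℤ.≤ i ℤ.+ n → (i ℤ.+ n) ℤ.* (F ℤ.* m) ℤ.< n ℤ.* (c ℤ.+ m) → c ℤ.≤ l ℤ.+ J ℤ.* m →
  (i ℤ.+ n) ℤ.* l ℤ.≤ i ℤ.* (c ℤ.+ m ℤ.- + 1) → (i ℤ.+ n) ℤ.* (F ℤ.* m) ℤ.< (i ℤ.+ n) ℤ.* ((+ 1 ℤ.+ J) ℤ.* m)
scaled-lower c m i n l J F 0≤i 0≤h p q u = by-slack< (0≤+ (0≤+ (0≤+ (slack< p) (0≤* 0≤h (slack q))) (slack u)) 0≤i) (lem c m i n l J F)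
  where
  lem : ∀ c m i n l J F →
    n ℤ.* (c ℤ.+ m) ℤ.- (+ 1 ℤ.+ (i ℤ.+ n) ℤ.* (F ℤ.* m)) ℤ.+ (i ℤ.+ n) ℤ.* (l ℤ.+ J ℤ.* m ℤ.- c) ℤ.+ (i ℤ.* (c ℤ.+ m ℤ.- + 1) ℤ.- (i ℤ.+ n) ℤ.* l) ℤ.+ i
    ≡ (i ℤ.+ n) ℤ.* ((+ 1 ℤ.+ J) ℤ.* m) ℤ.- (+ 1 ℤ.+ (i ℤ.+ n) ℤ.* (F ℤ.* m))
  lem = ℤ-solve

-- The last slack n m b is given away: it reflects the gap n/h between c - λ ≤ n c/h and the bound
-- by n (c + m)/h.
scaled-upper : ∀ a b c m i n l F → + 0 ℤ.≤ b → + 0 ℤ.≤ m → + 0 ℤ.≤ n → + 0 ℤ.≤ i ℤ.+ n →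
  i ℤ.* c ℤ.≤ (i ℤ.+ n) ℤ.* l → a ℤ.* n ℤ.≤ (+ 1 ℤ.+ F) ℤ.* b → (c ℤ.+ m) ℤ.* b ℤ.≤ a ℤ.* ((i ℤ.+ n) ℤ.* m) →
  (i ℤ.+ n) ℤ.* (c ℤ.* b) ℤ.≤ (i ℤ.+ n) ℤ.* ((l ℤ.+ (+ 1 ℤ.+ F) ℤ.* m) ℤ.* b)
scaled-upper a b c m i n l F 0≤b 0≤m 0≤n 0≤h p q u = by-slack
  (0≤+ (0≤+ (0≤+ (0≤* 0≤b (slack p)) (0≤* (0≤* 0≤h 0≤m) (slack q))) (0≤* 0≤n (slack u))) (0≤* (0≤* 0≤n 0≤m) 0≤b)) (lem a b c m i n l F)
  where
  lem : ∀ a b c m i n l F →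
    b ℤ.* ((i ℤ.+ n) ℤ.* l ℤ.- i ℤ.* c) ℤ.+ (i ℤ.+ n) ℤ.* m ℤ.* ((+ 1 ℤ.+ F) ℤ.* b ℤ.- a ℤ.* n) ℤ.+ n ℤ.* (a ℤ.* ((i ℤ.+ n) ℤ.* m) ℤ.- (c ℤ.+ m) ℤ.* b) ℤ.+ n ℤ.* m ℤ.* b
    ≡ (i ℤ.+ n) ℤ.* ((l ℤ.+ (+ 1 ℤ.+ F) ℤ.* m) ℤ.* b) ℤ.- (i ℤ.+ n) ℤ.* (c ℤ.* b)
  lem = ℤ-solve

-- The case i = 0, λ = 0 of `scaled-upper` with the term n m b retained. For n = h that term is
-- worth a whole m, which improves F + 1 to F.
scaled-conductor : ∀ a b c m h F → + 0 ℤ.≤ m → a ℤ.* h ℤ.≤ (+ 1 ℤ.+ F) ℤ.* b → (c ℤ.+ m) ℤ.* b ℤ.≤ a ℤ.* (h ℤ.* m) → c ℤ.* b ℤ.≤ F ℤ.* m ℤ.* b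
scaled-conductor a b c m h F 0≤m p q = by-slack (0≤+ (0≤* 0≤m (slack p)) (slack q)) (lem a b c m h F)
  where
  lem : ∀ a b c m h F → m ℤ.* ((+ 1 ℤ.+ F) ℤ.* b ℤ.- a ℤ.* h) ℤ.+ (a ℤ.* (h ℤ.* m) ℤ.- (c ℤ.+ m) ℤ.* b) ≡ F ℤ.* m ℤ.* b ℤ.- c ℤ.* b
  lem = ℤ-solve

module EliahouNumber (m-1 g b-1 b'-1 : ℕ) (a a' c : ℤ) (Γ : ℤ → Set)
  (1≤g : 1 ℕ.≤ g) (pred : IsPred (suc g) a (suc b-1) a' (suc b'-1))
  (m<c : + suc m-1 ℤ.< c) (m<Γ : ∀ γ → Γ γ → + suc m-1 ℤ.< γ)
  (c≤hΓ : ∀ γ → Γ γ → c ℤ.≤ + suc g ℤ.* γ) (hΓ<c+m : ∀ γ → Γ γ → + suc g ℤ.* γ ℤ.< c ℤ.+ + suc m-1)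
  (γ₀ : ℤ) (G₀ : List ℤ) (G! : Unique (γ₀ ∷ G₀)) (G⇔ : ∀ γ → γ ∈ γ₀ ∷ G₀ ⇔ Γ γ)
  (a'-bound : a' ℤ.* (+ suc g ℤ.* + suc m-1) ℤ.< (c ℤ.+ + suc m-1) ℤ.* + suc b'-1)
  (a-bound : (c ℤ.+ + suc m-1) ℤ.* + suc b-1 ℤ.≤ a ℤ.* (+ suc g ℤ.* + suc m-1))
  (can : Canonical (suc m-1) Γ c) (cf : CollisionFree (suc g) (suc m-1) Γ)
  where

  open Semigroup m-1 c Γ m<c m<Γ
  open Counting m-1 g c Γ 1≤g m<c m<Γ c≤hΓ hΓ<c+m γ₀ G₀ G! G⇔ can cf

  b b' p : ℕ
  b = suc b-1
  b' = suc b'-1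
  p = length G

  F : ℕ → ℤ
  F n = floor ((+ n ℤ.* a') // b')

  f : ℕ → ℕ
  f n = ℤ.∣ F n ∣

  0<a : + 0 ℤ.< a
  0<a = ℤP.*-cancelʳ-<-nonNeg (+ h ℤ.* + m) (ℤP.<-≤-trans 0<cb a-bound)
    where
    0<cb : + 0 ℤ.* (+ h ℤ.* + m) ℤ.< (c ℤ.+ + m) ℤ.* + b
    0<cb = subst (ℤ._< (c ℤ.+ + m) ℤ.* + b) (trans (ℤP.*-zeroˡ (+ b)) (sym (ℤP.*-zeroˡ (+ h ℤ.* + m))))
      (ℤP.*-monoʳ-<-pos (+ b) (ℤP.+-mono-≤-< 0≤c (ℤ.+<+ (s≤s z≤n))))

  -- 0/1 is an h-Farey fraction below a/b.
  0≤a' : + 0 ℤ.≤ a'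
  0≤a' = subst₂ ℤ._≤_ (ℤP.*-zeroˡ (+ b')) (ℤP.*-identityʳ a')
    (proj₂ (proj₂ pred) (+ 0) 1 (s≤s z≤n , s≤s z≤n , refl) (subst₂ ℤ._<_ (sym (ℤP.*-zeroˡ (+ b))) (sym (ℤP.*-identityʳ a)) 0<a))

  +f : ∀ n → + f n ≡ F n
  +f n = ℤP.0≤i⇒+∣i∣≡i (≤floor-// (+ 0) (+ n ℤ.* a') b'-1 (subst (ℤ._≤ + n ℤ.* a') (sym (ℤP.*-zeroˡ (+ b'))) (0≤* (0≤pos n) 0≤a')))

  F-lower : ∀ n → F n ℤ.* + b' ℤ.≤ + n ℤ.* a'
  F-lower n = ≤floor-//⁻ (F n) (+ n ℤ.* a') b'-1 ℤP.≤-refl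

  f0≡0 : f 0 ≡ 0
  f0≡0 = ℕP.n≤0⇒n≡0 (ℤP.drop‿+≤+ (subst (ℤ._≤ + 0) (sym (+f 0)) (ℤP.*-cancelʳ-≤-pos (F 0) (+ 0) (+ b')
    (subst (F 0 ℤ.* + b' ℤ.≤_) (trans (ℤP.*-zeroˡ a') (sym (ℤP.*-zeroˡ (+ b')))) (F-lower 0)))))

  module _ {i : ℕ} {λ' : ℤ} (i<h : i ℕ.< h) (s : Sumset i Γ λ') where

    private
      n : ℕ
      n = h ℕ.∸ i
      1≤n : 1 ℕ.≤ n
      1≤n = ℕP.m<n⇒0<n∸m i<h
      i+n≡h : + i ℤ.+ + n ≡ + h
      i+n≡h = cong +_ (ℕP.m+[n∸m]≡n (ℕP.<⇒≤ i<h))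
      λ<c+m : λ' ℤ.< c ℤ.+ + m
      λ<c+m = Sumset<c+m (ℕP.<⇒≤ i<h) s

    f≤J : f n ℕ.≤ J λ'
    f≤J = ℤP.drop‿+≤+ (subst (ℤ._≤ + J λ') (sym (+f n)) (<suc⇒≤ (ℤP.*-cancelʳ-<-nonNeg (+ m) (ℤP.*-cancelˡ-<-nonNeg (+ h)
      (subst (λ h → h ℤ.* (F n ℤ.* + m) ℤ.< h ℤ.* ((+ 1 ℤ.+ + J λ') ℤ.* + m)) i+n≡h
        (scaled-lower c (+ m) (+ i) (+ n) λ' (+ J λ') (F n) (0≤pos i) (0≤pos (i ℕ.+ n))
          (subst (λ h → h ℤ.* (F n ℤ.* + m) ℤ.< + n ℤ.* (c ℤ.+ + m)) (sym i+n≡h) (ℤP.*-cancelʳ-<-nonNeg (+ b')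
            (scaled-floor< a' (+ b') c (+ h) (+ m) (+ n) (F n) (0≤pos h) (0≤pos m) (ℤ.+≤+ 1≤n) a'-bound (F-lower n))))
          (c≤λ+Jm λ' λ<c+m)
          (subst (λ h → h ℤ.* λ' ℤ.≤ + i ℤ.* (c ℤ.+ + m ℤ.- + 1)) (sym i+n≡h) (Sumset-upper s))))))))

    J≤suc-f : J λ' ℕ.≤ suc (f n)
    J≤suc-f = Equivalence.from (J≤⇔ λ' λ<c+m (suc (f n))) (subst (λ F → c ℤ.≤ λ' ℤ.+ (+ 1 ℤ.+ F) ℤ.* + m) (sym (+f n))
      (ℤP.*-cancelʳ-≤-pos c (λ' ℤ.+ (+ 1 ℤ.+ F n) ℤ.* + m) (+ b) (ℤP.*-cancelˡ-≤-pos (c ℤ.* + b) ((λ' ℤ.+ (+ 1 ℤ.+ F n) ℤ.* + m) ℤ.* + b) (+ h)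
        (subst (λ h → h ℤ.* (c ℤ.* + b) ℤ.≤ h ℤ.* ((λ' ℤ.+ (+ 1 ℤ.+ F n) ℤ.* + m) ℤ.* + b)) i+n≡h
          (scaled-upper a (+ b) c (+ m) (+ i) (+ n) λ' (F n) (0≤pos b) (0≤pos m) (0≤pos n) (0≤pos (i ℕ.+ n))
            (subst (λ h → + i ℤ.* c ℤ.≤ h ℤ.* λ') (sym i+n≡h) (Sumset-lower s))
            (suc-floor-bound h a a' b-1 b'-1 pred n 1≤n (ℕP.m∸n≤m h i))
            (subst (λ h → (c ℤ.+ + m) ℤ.* + b ℤ.≤ a ℤ.* (h ℤ.* + m)) (sym i+n≡h) a-bound))))))

  J-h≡0 : ∀ {λ'} → Sumset h Γ λ' → J λ' ≡ 0
  J-h≡0 {λ'} s = ℕP.n≤0⇒n≡0 (Equivalence.from (J≤⇔ λ' (Sumset<c+m ℕP.≤-refl s) 0)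
    (subst (c ℤ.≤_) (sym (lem λ' (+ m))) (c≤Sumset ℕP.≤-refl s)))
    where
    lem : ∀ l m → l ℤ.+ + 0 ℤ.* m ≡ l
    lem = ℤ-solve

  f≤J≤suc-f : ∀ {p} → p ∈ P → f (h ℕ.∸ proj₁ p) ℕ.≤ J (proj₂ p) × J (proj₂ p) ℕ.≤ suc (f (h ℕ.∸ proj₁ p))
  f≤J≤suc-f {i , λ'} p∈ with ∈P⁻ p∈
  ... | i≤h , s with ℕP.m≤n⇒m<n∨m≡n i≤h
  ...   | inj₁ i<h = f≤J i<h s , J≤suc-f i<h s
  ...   | inj₂ refl rewrite J-h≡0 s | ℕP.n∸n≡0 i | f0≡0 = z≤n , z≤n

  -- At i = h both sides of the last inequality vanish, so admitting i = h adds nothing.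
  IsLong⇔ : ∀ q → IsLong h a' b' c m Γ q ⇔ (proj₁ q ℕ.≤ h × Sumset (proj₁ q) Γ (proj₂ q) × f (h ℕ.∸ proj₁ q) ℕ.< J (proj₂ q))
  IsLong⇔ (i , λ') = mk⇔ to from
    where
    to : IsLong h a' b' c m Γ (i , λ') → i ℕ.≤ h × Sumset i Γ λ' × f (h ℕ.∸ i) ℕ.< J λ'
    to (i<h , s , lt) = ℕP.<⇒≤ i<h , s , ℤP.drop‿+<+ (subst₂ ℤ._<_ (sym (+f (h ℕ.∸ i))) (sym (+J λ' (Sumset<c+m (ℕP.<⇒≤ i<h) s))) lt)
    from : i ℕ.≤ h × Sumset i Γ λ' × f (h ℕ.∸ i) ℕ.< J λ' → IsLong h a' b' c m Γ (i , λ')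
    from (i≤h , s , lt) with ℕP.m≤n⇒m<n∨m≡n i≤h
    ... | inj₁ i<h = i<h , s , subst₂ ℤ._<_ (+f (h ℕ.∸ i)) (+J λ' (Sumset<c+m i≤h s)) (ℤ.+<+ lt)
    ... | inj₂ refl = contradiction (subst (f (h ℕ.∸ h) ℕ.<_) (J-h≡0 s) lt) λ ()

  -- The ceiling q is `J` at the empty sum λ = 0, so `f≤J` bounds it from below and the sharper
  -- `scaled-conductor` from above.
  q≡F : qOf c m ≡ F h
  q≡F = trans (cong (λ x → ceiling (x // m)) (sym (ℤP.+-identityʳ c))) (trans (sym (+J (+ 0) 0<c+m)) (trans (cong +_ (ℕP.≤-antisym J≤f (f≤J {0} (s≤s z≤n) ([] , refl , [] , refl)))) (+f h)))
    where
    0<c+m : + 0 ℤ.< c ℤ.+ + m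
    0<c+m = ℤP.+-mono-≤-< 0≤c (ℤ.+<+ (s≤s z≤n))
    J≤f : J (+ 0) ℕ.≤ f h
    J≤f = Equivalence.from (J≤⇔ (+ 0) 0<c+m (f h)) (subst (c ℤ.≤_) (sym (trans (ℤP.+-identityˡ (+ f h ℤ.* + m)) (cong (ℤ._* + m) (+f h))))
      (ℤP.*-cancelʳ-≤-pos c (F h ℤ.* + m) (+ b) (scaled-conductor a (+ b) c (+ m) (+ h) (F h) (0≤pos m)
        (suc-floor-bound h a a' b-1 b'-1 pred h (s≤s z≤n) ℕP.≤-refl) a-bound)))

  eliahou : ∀ {k r ω} →
    IsCard (λ x → InS m Γ c x × x ℤ.< c) k →
    IsCard (λ x → Primitive m Γ c x × c ℤ.≤ x) r →
    IsCard (IsLong h a' b' c m Γ) ω →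
    toℚ (EOf c m k (suc p) r) ≡ E0-1 h a' b' (suc p) ℚ.+ toℚ (ρOf c m) ℚ.+ ℕℚ (suc p) ℚ.* ℕℚ ω
  eliahou {k} {r} {ω} card-k card-r card-ω = begin
    toℚ (EOf c m k (suc p) r)
      ≡⟨ trans (toℚ-- (+ (k ℕ.* suc p) ℤ.+ q ℤ.* + r) c) (cong (ℚ._- C) (trans (toℚ-+ (+ (k ℕ.* suc p)) (q ℤ.* + r)) (cong₂ ℚ._+_ (ℕℚ-* k (suc p)) (toℚ-* q (+ r))))) ⟩
    ℕℚ k ℚ.* L ℚ.+ Q ℚ.* R ℚ.- C
      ≡⟨ cong (λ x → x ℚ.* L ℚ.+ Q ℚ.* R ℚ.- C) k≡ ⟩
    (K ℚ.+ ℕℚ ω) ℚ.* L ℚ.+ Q ℚ.* R ℚ.- C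
      -- The product Q S is subtracted in the first bracket and added in the second, where R + S = m
      -- turns it into ρ = q m - c.
      ≡⟨ lem K (ℕℚ ω) L Q R C S ⟩
    (L ℚ.* K ℚ.- Q ℚ.* S) ℚ.+ (Q ℚ.* (R ℚ.+ S) ℚ.- C) ℚ.+ L ℚ.* ℕℚ ω
      ≡⟨ cong₂ (λ x y → x ℚ.+ y ℚ.+ L ℚ.* ℕℚ ω) E0≡ ρ≡ ⟨
    E0-1 h a' b' (suc p) ℚ.+ toℚ (ρOf c m) ℚ.+ L ℚ.* ℕℚ ω ∎
    where
    open ≡-Reasoning
    q : ℤ
    q = qOf c m
    s : ℕ → ℚ
    s i = ℕℚ (mch p i)
    L Q R C S K : ℚ
    L = ℕℚ (suc p)
    Q = toℚ q
    R = ℕℚ r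
    C = toℚ c
    S = ℕℚ (mch (suc p) h)
    K = Σ< h (λ i → toℚ (F (h ℕ.∸ i)) ℚ.* s i)
    lem : ∀ K w L Q R C S → (K ℚ.+ w) ℚ.* L ℚ.+ Q ℚ.* R ℚ.- C ≡ (L ℚ.* K ℚ.- Q ℚ.* S) ℚ.+ (Q ℚ.* (R ℚ.+ S) ℚ.- C) ℚ.+ L ℚ.* w
    lem = solve-∀ ℚ-ring
    E0≡ : E0-1 h a' b' (suc p) ≡ L ℚ.* K ℚ.- Q ℚ.* S
    E0≡ = trans (E0-1-floor h a a' b-1 b'-1 pred p) (cong (λ x → L ℚ.* K ℚ.- toℚ x ℚ.* S) (sym q≡F))
    ρ≡ : toℚ (ρOf c m) ≡ Q ℚ.* (R ℚ.+ S) ℚ.- C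
    ρ≡ = begin
      toℚ (q ℤ.* + m ℤ.- c)                     ≡⟨ trans (toℚ-- (q ℤ.* + m) c) (cong (ℚ._- C) (toℚ-* q (+ m))) ⟩
      Q ℚ.* ℕℚ m ℚ.- C                          ≡⟨ cong (λ x → Q ℚ.* ℕℚ x ℚ.- C) (r-count card-r) ⟨
      Q ℚ.* ℕℚ (r ℕ.+ length P) ℚ.- C           ≡⟨ cong (λ x → Q ℚ.* x ℚ.- C) (ℕℚ-+ r (length P)) ⟩
      Q ℚ.* (R ℚ.+ ℕℚ (length P)) ℚ.- C         ≡⟨ cong (λ x → Q ℚ.* (R ℚ.+ x) ℚ.- C)
        (trans (cong ℕℚ length-P) (trans (ℕℚ-sum (mch p) (upTo (suc h))) (Σ<-mch p h))) ⟩
      Q ℚ.* (R ℚ.+ S) ℚ.- C                     ∎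
    k≡ : ℕℚ k ≡ K ℚ.+ ℕℚ ω
    k≡ = begin
      ℕℚ k                                      ≡⟨ cong ℕℚ (k-count-long (λ i → f (h ℕ.∸ i)) f≤J≤suc-f card-k
        (record { elems = IsCard.elems card-ω ; unique = IsCard.unique card-ω ; size = IsCard.size card-ω
                ; complete = λ q → ⇔.trans (IsCard.complete card-ω q) (IsLong⇔ q) })) ⟩
      ℕℚ (sum (map (λ i → f (h ℕ.∸ i) ℕ.* mch p i) (upTo (suc h))) ℕ.+ ω)
        ≡⟨ trans (ℕℚ-+ (sum (map (λ i → f (h ℕ.∸ i) ℕ.* mch p i) (upTo (suc h)))) ω) (cong (ℚ._+ ℕℚ ω) (ℕℚ-sum (λ i → f (h ℕ.∸ i) ℕ.* mch p i) (upTo (suc h)))) ⟩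
      Σ< (suc h) (λ i → ℕℚ (f (h ℕ.∸ i) ℕ.* mch p i)) ℚ.+ ℕℚ ω
        ≡⟨ cong (ℚ._+ ℕℚ ω) (Σ<-suc h (λ i → ℕℚ (f (h ℕ.∸ i) ℕ.* mch p i))) ⟩
      Σ< h (λ i → ℕℚ (f (h ℕ.∸ i) ℕ.* mch p i)) ℚ.+ ℕℚ (f (h ℕ.∸ h) ℕ.* mch p h) ℚ.+ ℕℚ ω
        ≡⟨ cong₂ (λ x y → x ℚ.+ y ℚ.+ ℕℚ ω)
             (Σ<-cong h (λ i _ → trans (ℕℚ-* (f (h ℕ.∸ i)) (mch p i)) (cong (λ x → toℚ x ℚ.* s i) (+f (h ℕ.∸ i)))))
             (cong (λ x → ℕℚ (x ℕ.* mch p h)) (trans (cong f (ℕP.n∸n≡0 h)) f0≡0)) ⟩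
      K ℚ.+ 0ℚ ℚ.+ ℕℚ ω                         ≡⟨ cong (ℚ._+ ℕℚ ω) (ℚP.+-identityʳ K) ⟩
      K ℚ.+ ℕℚ ω                                ∎

  conclusion : ∀ {k ℓ r ω} → suc p ≡ ℓ →
    IsCard (λ x → InS m Γ c x × x ℤ.< c) k →
    IsCard (λ x → Primitive m Γ c x × c ℤ.≤ x) r →
    IsCard (IsLong h a' b' c m Γ) ω →
    (toℚ (EOf c m k ℓ r) ≡ E0-1 h a' b' ℓ ℚ.+ toℚ (ρOf c m) ℚ.+ ℕℚ ℓ ℚ.* ℕℚ ω)
    × (E0-1 h a' b' ℓ ≡ E0-2 h a b ℓ)
    × (E0-1 h a' b' ℓ ≡ E0-3 h a' b' ℓ)
    × (E0-1 h a' b' ℓ ≡ E0-4 h a b ℓ)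
  conclusion refl card-k card-r card-ω = eliahou card-k card-r card-ω
    , E0-1≡E0-2 h a a' b-1 b'-1 pred p
    , E0-1≡E0-3 h a a' b-1 b'-1 pred p
    , trans (E0-1≡E0-2 h a a' b-1 b'-1 pred p) (E0-2≡E0-4 h a a' b-1 b'-1 pred p)

-- From Δ to an enumeration of Γ

∈-map-difference⇔ : ∀ t Δ γ → γ ∈ map (λ δ → t ℤ.- + δ) Δ ⇔ Σ ℕ λ δ → (δ ∈ Δ) × (γ ≡ t ℤ.- + δ)
∈-map-difference⇔ t Δ γ = mk⇔ (∈-map⁻ (λ δ → t ℤ.- + δ)) λ { (δ , δ∈ , refl) → ∈-map⁺ (λ δ → t ℤ.- + δ) δ∈ }

-- The -1 under the floor that defines Γ makes the bound strict, and subtracting δ ≥ 0 only lowers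
-- γ.
GammaOf< : ∀ g c m Δ γ → GammaOf (suc g) c m Δ γ → + suc g ℤ.* γ ℤ.< c ℤ.+ + m
GammaOf< g c m Δ γ (δ , _ , γ≡) = <-pred⇒≤ (+ suc g ℤ.* γ) (c ℤ.+ + m) (subst (ℤ._≤ x) (ℤP.*-comm γ (+ suc g))
  (≤floor-//⁻ γ x g (subst₂ ℤ._≤_ (sym γ≡) (ℤP.+-identityʳ _) (ℤP.+-monoʳ-≤ (floor (x // suc g)) (ℤP.neg-mono-≤ (0≤pos δ))))))
  where
  x : ℤ
  x = c ℤ.+ + m ℤ.- + 1

theorem3p1 : (h : ℕ) → 2 ℕ.≤ h →
    (a : ℤ) (b : ℕ) → IsFarey h a b →
    (a' : ℤ) (b' : ℕ) → IsPred h a b a' b' →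
    (Δ : List ℕ) (τ : ℤ) (m : ℕ) → 1 ℕ.≤ m →
    let c = cOf h a b τ m
        Γ = GammaOf h c m Δ
    in
    + m ℤ.< c →
    (∀ γ → Γ γ → + m ℤ.< γ) →
    (γ₁ : ℤ) → Γ γ₁ → (∀ γ → Γ γ → γ₁ ℤ.≤ γ) →
    c ℤ.+ + m ℤ.- + h ℤ.* γ₁ ℤ.≤ + m →
    a' ℤ.* (+ h ℤ.* + m) ℤ.< (c ℤ.+ + m) ℤ.* + b' →
    (c ℤ.+ + m) ℤ.* + b ℤ.≤ a ℤ.* (+ h ℤ.* + m) →
    Canonical m Γ c →
    CollisionFree h m Γ →
    (k ℓ r ω : ℕ) →
    IsCard (λ x → InS m Γ c x × x ℤ.< c) k →
    IsCard (λ x → Primitive m Γ c x × x ℤ.< c) ℓ →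
    IsCard (λ x → Primitive m Γ c x × c ℤ.≤ x) r →
    IsCard (IsLong h a' b' c m Γ) ω →
    (toℚ (EOf c m k ℓ r) ≡ E0-1 h a' b' ℓ ℚ.+ toℚ (ρOf c m) ℚ.+ ℕℚ ℓ ℚ.* ℕℚ ω)
    × (E0-1 h a' b' ℓ ≡ E0-2 h a b ℓ)
    × (E0-1 h a' b' ℓ ≡ E0-3 h a' b' ℓ)
    × (E0-1 h a' b' ℓ ≡ E0-4 h a b ℓ)
theorem3p1 h@(suc g) (s≤s 1≤g) a b@(suc b-1) _ a' b'@(suc b'-1) pred Δ τ m@(suc m-1) _
  m<c m<Γ γ₁ γ₁∈ γ₁-min w≤m a'-bound a-bound can cf k ℓ r ω card-k card-ℓ card-r card-ω =
  split G (deduplicate-! all) G⇔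
  where
  c : ℤ
  c = cOf h a b τ m
  Γ : ℤ → Set
  Γ = GammaOf h c m Δ
  top-γ : ℤ
  top-γ = floor ((c ℤ.+ + m ℤ.- + 1) // h)
  all G : List ℤ
  all = map (λ δ → top-γ ℤ.- + δ) Δ
  -- The list Δ may repeat entries, while Γ is to be counted as a set.
  G = deduplicate ℤP._≟_ all
  G⇔ : ∀ γ → γ ∈ G ⇔ Γ γ
  G⇔ γ = ⇔.trans (⇔.sym (deduplicate-∈⇔ ℤP._≟_)) (∈-map-difference⇔ top-γ Δ γ)
  hΓ<c+m : ∀ γ → Γ γ → + h ℤ.* γ ℤ.< c ℤ.+ + m
  hΓ<c+m = GammaOf< g c m Δ
  c≤hΓ : ∀ γ → Γ γ → c ℤ.≤ + h ℤ.* γ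
  -- The assumption w ≤ m says c ≤ h γ₁, and γ₁ is the minimum of Γ.
  c≤hΓ γ γ∈ = ℤP.≤-trans (c≤hγ₁ c (+ m) (+ h ℤ.* γ₁) w≤m) (ℤP.*-monoˡ-≤-nonNeg (+ h) (γ₁-min γ γ∈))
    where
    c≤hγ₁ : ∀ c m x → c ℤ.+ m ℤ.- x ℤ.≤ m → c ℤ.≤ x
    c≤hγ₁ c m x le = by-slack (slack le) (lem c m x)
      where
      lem : ∀ c m x → m ℤ.- (c ℤ.+ m ℤ.- x) ≡ x ℤ.- c
      lem = ℤ-solve
  split : ∀ G → Unique G → (∀ γ → γ ∈ G ⇔ Γ γ) →
    (toℚ (EOf c m k ℓ r) ≡ E0-1 h a' b' ℓ ℚ.+ toℚ (ρOf c m) ℚ.+ ℕℚ ℓ ℚ.* ℕℚ ω)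
    × (E0-1 h a' b' ℓ ≡ E0-2 h a b ℓ)
    × (E0-1 h a' b' ℓ ≡ E0-3 h a' b' ℓ)
    × (E0-1 h a' b' ℓ ≡ E0-4 h a b ℓ)
  -- The minimum γ₁ belongs to Γ, so the enumeration has a first element.
  split [] _ G⇔ = contradiction (Equivalence.from (G⇔ γ₁) γ₁∈) λ ()
  split (γ₀ ∷ G₀) G! G⇔ =
    EliahouNumber.conclusion m-1 g b-1 b'-1 a a' c Γ 1≤g pred m<c m<Γ c≤hΓ hΓ<c+m γ₀ G₀ G! G⇔ a'-bound a-bound can cf
      (Counting.ℓ-count m-1 g c Γ 1≤g m<c m<Γ c≤hΓ hΓ<c+m γ₀ G₀ G! G⇔ can cf card-ℓ)
      card-k card-r card-ω
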